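{- There exist absolute constants $C_1,C_2>0$ such that $$\left\lfloor\frac{n^2}{4}\right\rfloor-C_1n^{4/3}\;\leq\;\sigma_n\;\leq\;\left\lfloor\frac{n^2}{4}\right\rfloor-C_2n^{4/3}$$ for every sufficiently large integer $n$, where $\sigma_n=\max_{|V(G)|=n}\bigl(\operatorname{cp}(G)-\operatorname{cc}(G)\bigr)$, the maximum being over all graphs $G$ on $n$ vertices.
   Context: All graphs are finite, simple and undirected. A clique of a graph $G$ is a complete subgraph of $G$ (cliques of order two, i.e. single edges, are allowed). A clique covering of $G$ is a family of cliques of $G$ whose union contains $E(G)$. A clique partition of $G$ is a clique covering in which every edge of $G$ lies in exactly one member of the family. $\operatorname{cc}(G)$ and $\operatorname{cp}(G)$ denote the minimum possible number of members of a clique covering and of a clique partition of $G$, respectively. -}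

module Defs where

open import Level using (Level; 0ℓ)
open import Data.Bool using (Bool; true; false; T)
import Data.Bool.Properties as Bool
open import Data.Nat as ℕ using (ℕ; zero; suc)
import Data.Nat.Properties as ℕ
open import Data.Integer as ℤ using (ℤ; +_)
import Data.Integer.Properties as ℤ
open import Data.Rational as ℚ using (ℚ)
open import Data.Fin using (Fin; combine; remQuot; _<_)
open import Data.Fin.Properties
  using (all?; any?; _≟_; _<?_; <-cmp; <-asym; <-irrefl; remQuot-combine; combine-remQuot)
open import Data.Fin.Subset using (Subset; _∈_; _∪_; ⁅_⁆) renaming (⊥ to ∅)
open import Data.Fin.Subset.Properties
  using (_∈?_; anySubset?; ∉⊥; x∈⁅x⁆; x∈⁅y⁆⇒x≡y; x∈p∪q⁻; x∈p∪q⁺)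
open import Data.Vec using (Vec; []; _∷_; lookup; tabulate)
open import Data.Vec.Properties using (lookup∘tabulate)
open import Data.Product using (∃; ∃!; _×_; _,_; proj₁; proj₂; uncurry)
open import Data.Sum using (_⊎_; inj₁; inj₂)
open import Data.Empty using (⊥-elim)
open import Function using (_∘_)
open import Relation.Nullary using (Dec; yes; no; isYes; toWitness; fromWitness)
open import Relation.Nullary.Decidable using (map′; _×-dec_; _→-dec_; ¬?)
open import Relation.Unary using (Pred; Decidable)
open import Relation.Binary as B using (Rel; Symmetric; Irreflexive; tri<; tri≈; tri>)
open import Relation.Binary.PropositionalEquality
  using (_≡_; _≢_; refl; sym; trans; cong; cong₂; subst)

private
  variable
    a ℓ : Level
    n k : ℕ

record Graph (n : ℕ) : Set₁ where
  field
    Adj    : Rel (Fin n) 0ℓ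
    adj?   : B.Decidable Adj
    symm   : Symmetric Adj
    irrefl : Irreflexive _≡_ Adj

open Graph public

-- A complete subgraph is identified with its vertex set, so its edges are the
-- pairs of distinct vertices of that set.  Sets with fewer than two vertices
-- also qualify; they carry no edge, so this does not affect cc and cp.
IsClique : Graph n → Subset n → Set
IsClique G S = ∀ u v → u ∈ S → v ∈ S → u ≢ v → Adj G u v

IsCliqueCovering : Graph n → Vec (Subset n) k → Set
IsCliqueCovering G F =
  (∀ i → IsClique G (lookup F i)) ×
  (∀ u v → Adj G u v → ∃ λ i → u ∈ lookup F i × v ∈ lookup F i)

IsCliquePartition : Graph n → Vec (Subset n) k → Set
IsCliquePartition G F =
  IsCliqueCovering G F ×
  (∀ u v → Adj G u v → ∃! _≡_ λ i → u ∈ lookup F i × v ∈ lookup F i)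

HasCliqueCovering : Graph n → ℕ → Set
HasCliqueCovering {n} G k = ∃ λ (F : Vec (Subset n) k) → IsCliqueCovering G F

HasCliquePartition : Graph n → ℕ → Set
HasCliquePartition {n} G k = ∃ λ (F : Vec (Subset n) k) → IsCliquePartition G F

IsMinimum : Pred ℕ ℓ → Pred ℕ ℓ
IsMinimum P m = P m × (∀ j → P j → m ℕ.≤ j)

IsMinimum-unique : {P Q : Pred ℕ ℓ} → (∀ j → P j → Q j) → (∀ j → Q j → P j) →
                   ∀ {m m′} → IsMinimum P m → IsMinimum Q m′ → m ≡ m′
IsMinimum-unique P⇒Q Q⇒P (p , p-min) (q , q-min) =
  ℕ.≤-antisym (p-min _ (Q⇒P _ q)) (q-min _ (P⇒Q _ p))

private
  minimum-exists : {P : Pred ℕ ℓ} → Decidable P → ∀ m → P m → ∃ (IsMinimum P)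
  minimum-exists P? zero p = zero , p , λ _ _ → ℕ.z≤n
  minimum-exists {P = P} P? (suc m) p with P? zero
  ... | yes p₀ = zero , p₀ , λ _ _ → ℕ.z≤n
  ... | no ¬p₀ with minimum-exists (P? ∘ suc) m p
  ...   | k , pk , k-min = suc k , pk , least
    where
    least : ∀ j → P j → suc k ℕ.≤ j
    least zero    q = ⊥-elim (¬p₀ q)
    least (suc j) q = ℕ.s≤s (k-min j q)

  anyFamily? : {P : Pred (Vec (Subset n) k) ℓ} → Decidable P → Dec (∃ P)
  anyFamily? {k = zero} P? = map′ ([] ,_) (λ { ([] , p) → p }) (P? [])
  anyFamily? {k = suc k} P? =
    map′ (λ { (S , F , p) → S ∷ F , p }) (λ { (S ∷ F , p) → S , F , p })
      (anySubset? λ S → anyFamily? λ F → P? (S ∷ F))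

  ∃!? : {P : Pred (Fin n) ℓ} → Decidable P → Dec (∃! _≡_ P)
  ∃!? P? =
    map′ (λ { (i , p , u) → i , p , λ {j} → u j }) (λ { (i , p , u) → i , p , λ j → u {j} })
      (any? λ i → P? i ×-dec all? λ j → P? j →-dec (i ≟ j))

  covering? : (G : Graph n) → Decidable {A = Vec (Subset n) k} (IsCliqueCovering G)
  covering? G F =
    (all? λ i → all? λ u → all? λ v →
      (u ∈? lookup F i) →-dec ((v ∈? lookup F i) →-dec (¬? (u ≟ v) →-dec adj? G u v)))
    ×-dec
    (all? λ u → all? λ v → adj? G u v →-dec
      any? λ i → (u ∈? lookup F i) ×-dec (v ∈? lookup F i))

  partition? : (G : Graph n) → Decidable {A = Vec (Subset n) k} (IsCliquePartition G)
  partition? G F =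
    covering? G F ×-dec
    (all? λ u → all? λ v → adj? G u v →-dec
      ∃!? λ i → (u ∈? lookup F i) ×-dec (v ∈? lookup F i))

  module EdgePartition {n} (G : Graph n) where
    member : Fin n → Fin n → Subset n
    member u v with u <? v | adj? G u v
    ... | yes _ | yes _ = ⁅ u ⁆ ∪ ⁅ v ⁆
    ... | _     | _     = ∅

    ∈-pair : ∀ {x} (u v : Fin n) → x ∈ ⁅ u ⁆ ∪ ⁅ v ⁆ → x ≡ u ⊎ x ≡ v
    ∈-pair u v x∈ with x∈p∪q⁻ ⁅ u ⁆ ⁅ v ⁆ x∈
    ... | inj₁ p = inj₁ (x∈⁅y⁆⇒x≡y u p)
    ... | inj₂ p = inj₂ (x∈⁅y⁆⇒x≡y v p)

    ∈-member : ∀ {x} u v → x ∈ member u v → u < v × Adj G u v × (x ≡ u ⊎ x ≡ v)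
    ∈-member u v x∈ with u <? v | adj? G u v
    ... | yes u<v | yes e = u<v , e , ∈-pair u v x∈
    ... | yes _   | no _  = ⊥-elim (∉⊥ x∈)
    ... | no _    | _     = ⊥-elim (∉⊥ x∈)

    member-∋ : ∀ u v → u < v → Adj G u v → u ∈ member u v × v ∈ member u v
    member-∋ u v u<v e with u <? v | adj? G u v
    ... | yes _  | yes _ = x∈p∪q⁺ (inj₁ (x∈⁅x⁆ u)) , x∈p∪q⁺ {p = ⁅ u ⁆} (inj₂ (x∈⁅x⁆ v))
    ... | yes _  | no ¬e = ⊥-elim (¬e e)
    ... | no u≮v | _     = ⊥-elim (u≮v u<v)

    member-clique : ∀ u v → IsClique G (member u v)
    member-clique u v x y x∈ y∈ x≢y with ∈-member u v x∈ | ∈-member u v y∈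
    ... | _ , e , inj₁ refl | _ , _ , inj₂ refl = e
    ... | _ , e , inj₂ refl | _ , _ , inj₁ refl = symm G e
    ... | _ , _ , inj₁ refl | _ , _ , inj₁ refl = ⊥-elim (x≢y refl)
    ... | _ , _ , inj₂ refl | _ , _ , inj₂ refl = ⊥-elim (x≢y refl)

    member-unique : ∀ {x y} u v → x < y → x ∈ member u v → y ∈ member u v → x ≡ u × y ≡ v
    member-unique u v x<y x∈ y∈ with ∈-member u v x∈ | ∈-member u v y∈
    ... | _       , _ , inj₁ refl | _ , _ , inj₂ refl = refl , refl
    ... | u<v     , _ , inj₂ refl | _ , _ , inj₁ refl = ⊥-elim (<-asym u<v x<y)
    ... | _       , _ , inj₁ refl | _ , _ , inj₁ refl = ⊥-elim (<-irrefl refl x<y)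
    ... | _       , _ , inj₂ refl | _ , _ , inj₂ refl = ⊥-elim (<-irrefl refl x<y)

    f : Fin (n ℕ.* n) → Subset n
    f i = uncurry member (remQuot n i)

    F : Vec (Subset n) (n ℕ.* n)
    F = tabulate f

    clique : ∀ i → IsClique G (lookup F i)
    clique i rewrite lookup∘tabulate f i = uncurry member-clique (remQuot n i)

    once< : ∀ u v → u < v → Adj G u v → ∃! _≡_ λ i → u ∈ lookup F i × v ∈ lookup F i
    once< u v u<v e = combine u v , here′ , λ {j} → unique j
      where
      eq : lookup F (combine u v) ≡ member u v
      eq = trans (lookup∘tabulate f (combine u v))
                 (cong (uncurry member) (remQuot-combine u v))
      here′ : u ∈ lookup F (combine u v) × v ∈ lookup F (combine u v)
      here′ = subst (λ S → u ∈ S × v ∈ S) (sym eq) (member-∋ u v u<v e)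
      unique : ∀ j → u ∈ lookup F j × v ∈ lookup F j → combine u v ≡ j
      unique j (u∈ , v∈) rewrite lookup∘tabulate f j
        with member-unique (proj₁ (remQuot {n} n j)) (proj₂ (remQuot {n} n j)) u<v u∈ v∈
      ... | p , q = trans (cong₂ combine p q) (combine-remQuot {n} n j)

    once : ∀ u v → Adj G u v → ∃! _≡_ λ i → u ∈ lookup F i × v ∈ lookup F i
    once u v e with <-cmp u v
    ... | tri< u<v _ _ = once< u v u<v e
    ... | tri≈ _ u≡v _ = ⊥-elim (irrefl G u≡v e)
    ... | tri> _ _ v<u with once< v u v<u (symm G e)
    ...   | i , (p , q) , un = i , (q , p) , λ { (x , y) → un (y , x) }

    covering : IsCliqueCovering G F
    covering = clique , λ u v e → let i , p , _ = once u v e in i , p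

    partition : IsCliquePartition G F
    partition = covering , once

abstract
  cc-exists : (G : Graph n) → ∃ (IsMinimum (HasCliqueCovering G))
  cc-exists {n} G =
    minimum-exists (λ _ → anyFamily? (covering? G)) (n ℕ.* n) (F , covering)
    where open EdgePartition G

  cp-exists : (G : Graph n) → ∃ (IsMinimum (HasCliquePartition G))
  cp-exists {n} G =
    minimum-exists (λ _ → anyFamily? (partition? G)) (n ℕ.* n) (F , partition)
    where open EdgePartition G

cc : Graph n → ℕ
cc G = proj₁ (cc-exists G)

cp : Graph n → ℕ
cp G = proj₁ (cp-exists G)

gap : Graph n → ℤ
gap G = + cp G ℤ.- + cc G

IsMaximumGap : ℕ → ℤ → Set₁
IsMaximumGap n s = (∃ λ (G : Graph n) → gap G ≡ s) × (∀ (G : Graph n) → gap G ℤ.≤ s)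

private
  covering-resp : {G H : Graph n} →
    (∀ u v → Adj G u v → Adj H u v) → (∀ u v → Adj H u v → Adj G u v) →
    (F : Vec (Subset n) k) → IsCliqueCovering G F → IsCliqueCovering H F
  covering-resp to from F (cl , cov) =
    (λ i u v u∈ v∈ u≢v → to u v (cl i u v u∈ v∈ u≢v)) , (λ u v e → cov u v (from u v e))

  partition-resp : {G H : Graph n} →
    (∀ u v → Adj G u v → Adj H u v) → (∀ u v → Adj H u v → Adj G u v) →
    (F : Vec (Subset n) k) → IsCliquePartition G F → IsCliquePartition H F
  partition-resp {G = G} {H} to from F (c , once) =
    covering-resp {G = G} {H} to from F c , λ u v e → once u v (from u v e)

  gap-resp : {G H : Graph n} →
    (∀ u v → Adj G u v → Adj H u v) → (∀ u v → Adj H u v → Adj G u v) → gap G ≡ gap H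
  gap-resp {G = G} {H} to from = cong₂ (λ x y → + x ℤ.- + y)
    (IsMinimum-unique (λ { _ (F , p) → F , partition-resp {G = G} {H} to from F p })
                      (λ { _ (F , p) → F , partition-resp {G = H} {G} from to F p })
                      (proj₂ (cp-exists G)) (proj₂ (cp-exists H)))
    (IsMinimum-unique (λ { _ (F , p) → F , covering-resp {G = G} {H} to from F p })
                      (λ { _ (F , p) → F , covering-resp {G = H} {G} from to F p })
                      (proj₂ (cc-exists G)) (proj₂ (cc-exists H)))

  HasArgmax : Set a → Set a
  HasArgmax A = (f : A → ℤ) → ∃ λ x → ∀ y → f y ℤ.≤ f x

  argmax-Bool : HasArgmax Bool
  argmax-Bool f with ℤ.≤-total (f true) (f false)
  ... | inj₁ t≤f = false , λ { true → t≤f ; false → ℤ.≤-refl }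
  ... | inj₂ f≤t = true  , λ { true → ℤ.≤-refl ; false → f≤t }

  argmax-Vec : {A : Set a} → HasArgmax A → ∀ k → HasArgmax (Vec A k)
  argmax-Vec mx zero f = [] , λ { [] → ℤ.≤-refl }
  argmax-Vec {A = A} mx (suc k) f = x ∷ tl x , λ { (y ∷ ys) →
      ℤ.≤-trans (proj₂ (argmax-Vec mx k (f ∘ (y ∷_))) ys) (x-max y) }
    where
    tl : A → Vec A k
    tl y = proj₁ (argmax-Vec mx k (f ∘ (y ∷_)))
    best : ∃ λ x → ∀ y → f (y ∷ tl y) ℤ.≤ f (x ∷ tl x)
    best = mx (λ y → f (y ∷ tl y))
    x     = proj₁ best
    x-max = proj₂ best

  Matrix : ℕ → Set
  Matrix n = Vec (Vec Bool n) n

  entry : Matrix n → Fin n → Fin n → Bool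
  entry M u v = lookup (lookup M u) v

  fromMatrix : Matrix n → Graph n
  fromMatrix M = record
    { Adj    = λ u v → u ≢ v × T (entry M u v) × T (entry M v u)
    ; adj?   = λ u v → ¬? (u ≟ v) ×-dec (Bool.T? (entry M u v) ×-dec Bool.T? (entry M v u))
    ; symm   = λ { (u≢v , p , q) → u≢v ∘ sym , q , p }
    ; irrefl = λ { u≡v (u≢v , _) → u≢v u≡v }
    }

  toMatrix : Graph n → Matrix n
  toMatrix G = tabulate λ u → tabulate λ v → isYes (adj? G u v)

  entry-toMatrix : (G : Graph n) → ∀ u v → entry (toMatrix G) u v ≡ isYes (adj? G u v)
  entry-toMatrix G u v = trans
    (cong (λ r → lookup r v) (lookup∘tabulate (λ u → tabulate λ v → isYes (adj? G u v)) u))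
    (lookup∘tabulate (λ v → isYes (adj? G u v)) v)

  gap-toMatrix : (G : Graph n) → gap G ≡ gap (fromMatrix (toMatrix G))
  gap-toMatrix G = gap-resp {G = G} {fromMatrix (toMatrix G)}
    (λ u v e → (λ u≡v → irrefl G u≡v e) , put u v e , put v u (symm G e))
    (λ { u v (_ , p , _) → toWitness (subst T (entry-toMatrix G u v) p) })
    where
    put : ∀ u v → Adj G u v → T (entry (toMatrix G) u v)
    put u v e = subst T (sym (entry-toMatrix G u v)) (fromWitness {a? = adj? G u v} e)

abstract
  σ-exists : ∀ n → ∃ (IsMaximumGap n)
  σ-exists n with argmax-Vec (argmax-Vec argmax-Bool n) n (gap ∘ fromMatrix)
  ... | M , M-max = gap (fromMatrix M) , (fromMatrix M , refl) , λ G →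
    subst (ℤ._≤ gap (fromMatrix M)) (sym (gap-toMatrix G)) (M-max (toMatrix G))

σ : ℕ → ℤ
σ n = proj₁ (σ-exists n)

fromℤ : ℤ → ℚ
fromℤ z = z ℚ./ 1

cube : ℚ → ℚ
cube x = x ℚ.* x ℚ.* x

infix 4 _≤_·_^4/3 _·_^4/3≤_

-- Comparison of a rational x with the real number C n^{4/3}.  As cubing is
-- strictly increasing on the reals, x ≤ C n^{4/3} means x³ ≤ C³ n⁴.  Rational C
-- suffices for existence claims: an upper bound allows enlarging a real C to a
-- rational one, and a lower bound allows shrinking it.
_≤_·_^4/3 : ℚ → ℚ → ℕ → Set
x ≤ C · n ^4/3 = cube x ℚ.≤ cube C ℚ.* fromℤ (+ (n ℕ.^ 4))

_·_^4/3≤_ : ℚ → ℕ → ℚ → Set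
C · n ^4/3≤ x = cube C ℚ.* fromℤ (+ (n ℕ.^ 4)) ℚ.≤ cube x

{-# OPTIONS --safe #-}
module Submission where

-- Both bounds take cliques on about r = n^{1/3} vertices as the critical size.
--
-- Lower bound on σ: put the even and the odd vertices into blocks of about r
-- consecutive numbers, and join two vertices if they differ in parity or share
-- a block.  Pairs of blocks cover this graph with O(n²/r²) cliques.  A member of
-- a clique partition with e even and o odd vertices covers e·o cross edges and
-- uses e(e-1) + o(o-1) ≥ e·o - 1 ordered pairs inside blocks, so cp is at least
-- ⌊n²/4⌋ - O(nr).
--
-- Upper bound on σ: remove vertices one at a time.  If N(v) is split into p
-- disjoint cliques, then these cliques, each extended by v, are p members that
-- dispose of v and of the edges inside the parts.  Splitting N(v) greedily into
-- triangles, edges and an independent set gives p ≤ n/2 for v of minimum degree,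
-- whence cp ≤ ⌊n²/4⌋.  Moreover p ≤ (1/2 - ε)n for some v, unless there are two
-- disjoint independent sets of linear size with quadratically many edges between
-- them.  If this never fails in the first r steps, ⌊n²/4⌋ - cp ≥ εnr.  If it
-- fails, note that each vertex has lost O(r) edges so far: a clique of the
-- original graph meets each of the two sets in O(r) vertices, so covering the
-- edges between them takes Ω(n²/r²) cliques, and cc is that large.

open import Defs
open import Algebra.Bundles using (CommutativeMonoid)
import Data.Bool as Bool
open import Data.Bool using (Bool; true; false; _∧_; _∨_; not; if_then_else_)
import Data.Bool.Properties as Bool
open import Data.Empty using (⊥; ⊥-elim)
open import Data.Fin using (Fin; zero; suc; toℕ; splitAt; fromℕ<; combine; remQuot)
import Data.Fin.Properties as Fin
open import Data.Fin.Subset using (Subset; _∈_)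
open import Data.Fin.Subset.Properties using (anySubset?)
import Data.Integer as ℤ
import Data.Integer.Properties as ℤ
import Data.Integer.Tactic.RingSolver as ℤ
open import Data.Nat hiding (_<_)
open import Data.Nat.DivMod
open import Data.Nat.Divisibility using (divides-refl)
open import Data.Nat.Properties
open import Data.Nat.Tactic.RingSolver using (solve-∀)
open import Data.Product hiding (map₁)
import Data.Rational as ℚ
import Data.Rational.Properties as ℚ
import Data.Rational.Unnormalised as ℚᵘ
import Data.Rational.Unnormalised.Properties as ℚᵘ
import Data.Sum
open import Data.Sum using (_⊎_; inj₁; inj₂; [_,_]′; map₁)
open import Data.Vec using (Vec; lookup; tabulate)
open import Data.Vec.Functional using (Vector; _++_)
open import Data.Vec.Properties using (lookup∘tabulate; []=⇒lookup; lookup⇒[]=)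
open import Function using (_∘_; const)
open import Relation.Nullary
open import Relation.Nullary.Decidable
  using (dec-true; dec-false; decidable-stable; from-yes; _×-dec_; _⊎-dec_; _→-dec_)
open import Relation.Binary.PropositionalEquality hiding ([_]; J)
open import Algebra.Properties.Semiring.Sum +-*-semiring

-- Linear arithmetic and finite sums

private variable
  k m n p q : ℕ

-- Linear arithmetic: the equation exhibits y - x as a nonnegative
-- combination of hypotheses, summed up in a ≤ b.
from-combination : ∀ {x y a b} → a ≤ b → x + b ≡ y + a → x ≤ y
from-combination {x} {y} {a} {b} a≤b eq =
  +-cancelʳ-≤ b x y (≤-trans (≤-reflexive eq) (+-monoʳ-≤ y a≤b))

sum-mono : {f g : Vector ℕ n} → (∀ i → f i ≤ g i) → sum f ≤ sum g
sum-mono {zero}  f≤g = z≤n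
sum-mono {suc n} f≤g = +-mono-≤ (f≤g zero) (sum-mono (f≤g ∘ suc))

sum-const : ∀ n c → sum {n} (const c) ≡ n * c
sum-const zero    c = refl
sum-const (suc n) c = cong (c +_) (sum-const n c)

term≤sum : (f : Vector ℕ n) → ∀ i → f i ≤ sum f
term≤sum f zero    = m≤m+n _ _
term≤sum f (suc i) = ≤-trans (term≤sum (f ∘ suc) i) (m≤n+m _ _)

sum-zero : {f : Vector ℕ n} → (∀ i → f i ≡ 0) → sum f ≡ 0
sum-zero {n} f≡0 = trans (sum-cong-≗ f≡0) (sum-replicate-zero n)

sum-positive : (f : Vector ℕ n) → 1 ≤ sum f → ∃ λ i → 1 ≤ f i
sum-positive {suc n} f 1≤ with f zero in eq
... | suc _ = zero , ≤-trans (s≤s z≤n) (≤-reflexive (sym eq))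
... | zero with sum-positive (f ∘ suc) 1≤
...   | i , 1≤fi = suc i , 1≤fi

sum-++ : ∀ {A : Set} (g : A → ℕ) (xs : Vector A p) (ys : Vector A q) →
         sum (g ∘ (xs ++ ys)) ≡ sum (g ∘ xs) + sum (g ∘ ys)
sum-++ {zero}  g xs ys = refl
sum-++ {suc p} g xs ys = trans
  (cong (g (xs zero) +_) (trans (sum-cong-≗ tail-++) (sum-++ g (xs ∘ suc) ys)))
  (sym (+-assoc (g (xs zero)) _ _))
  where
  tail-++ : ∀ i → g ((xs ++ ys) (suc i)) ≡ g (((xs ∘ suc) ++ ys) i)
  tail-++ i with splitAt p i
  ... | inj₁ _ = refl
  ... | inj₂ _ = refl

all-++ : ∀ {A : Set} (P : A → Set) (xs : Vector A p) (ys : Vector A q) →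
         (∀ i → P (xs i)) → (∀ i → P (ys i)) → ∀ i → P ((xs ++ ys) i)
all-++ {p} P xs ys pxs pys i with splitAt p i
... | inj₁ j = pxs j
... | inj₂ j = pys j

-- Indicators, and vertex sets as Boolean functions

[_] : Bool → ℕ
[ true ]  = 1
[ false ] = 0

[]≤1 : ∀ b → [ b ] ≤ 1
[]≤1 true  = ≤-refl
[]≤1 false = z≤n

[]-true : ∀ {b} → b ≡ true → [ b ] ≡ 1
[]-true = cong [_]

[]-false : ∀ {b} → b ≡ false → [ b ] ≡ 0
[]-false = cong [_]

[]-positive : ∀ {b} → 1 ≤ [ b ] → b ≡ true
[]-positive {true} _ = refl

[∧] : ∀ b c → [ b ∧ c ] ≡ [ b ] * [ c ]
[∧] true  c = sym (+-identityʳ [ c ])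
[∧] false c = refl

[]-mono : ∀ {b c} → (b ≡ true → c ≡ true) → [ b ] ≤ [ c ]
[]-mono {true}  h = ≤-reflexive (sym ([]-true (h refl)))
[]-mono {false} h = z≤n

[]-disjoint : ∀ {b c d} → (b ≡ true → d ≡ true) → (c ≡ true → d ≡ true) →
              (b ≡ true → c ≡ false) → [ b ] + [ c ] ≤ [ d ]
[]-disjoint {false}        b⇒d c⇒d disj = []-mono c⇒d
[]-disjoint {true} {c} {d} b⇒d c⇒d disj rewrite disj refl | b⇒d refl = ≤-refl

∧-true : ∀ {b c} → b ∧ c ≡ true → b ≡ true × c ≡ true
∧-true {true} {true} _ = refl , refl

true≢false : ∀ {b} → b ≡ true → b ≡ false → ⊥
true≢false refl ()

≡false : ∀ {b} → ¬ b ≡ true → b ≡ false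
≡false = Bool.¬-not

∣_∣ : (Fin n → Bool) → ℕ
∣ S ∣ = sum λ x → [ S x ]

infix 4 _⊆_
_⊆_ : (S R : Fin n → Bool) → Set
S ⊆ R = ∀ x → S x ≡ true → R x ≡ true

∣∣-mono : {S R : Fin n → Bool} → S ⊆ R → ∣ S ∣ ≤ ∣ R ∣
∣∣-mono S⊆R = sum-mono λ x → []-mono (S⊆R x)

δ : Fin n → Fin n → Bool
δ x w = does (x Fin.≟ w)

δ-refl : (x : Fin n) → δ x x ≡ true
δ-refl x = dec-true (x Fin.≟ x) refl

δ-≢ : {x w : Fin n} → x ≢ w → δ x w ≡ false
δ-≢ {x = x} {w} = dec-false (x Fin.≟ w)

δ-≡ : {x w : Fin n} → δ x w ≡ true → x ≡ w
δ-≡ {x = x} {w} eq with x Fin.≟ w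
... | yes x≡w = x≡w

∣δ∣ : (x : Fin n) → ∣ δ x ∣ ≡ 1
∣δ∣ {suc n} zero = cong suc (sum-zero {n} λ i → refl)
∣δ∣ (suc x) = trans (sum-cong-≗ shift) (∣δ∣ x)
  where
  shift : ∀ w → [ δ (suc x) (suc w) ] ≡ [ δ x w ]
  shift w with x Fin.≟ w
  ... | yes _ = refl
  ... | no  _ = refl

argmin : (S : Fin n → Bool) (f : Fin n → ℕ) → ∀ x → S x ≡ true →
         ∃ λ v → S v ≡ true × (∀ y → S y ≡ true → f v ≤ f y)
argmin {n} S f x Sx = go (f x) x Sx ≤-refl
  where
  -- Descent: `b` bounds the current value `f x`, which drops with every move to a smaller value.
  go : ∀ b x → S x ≡ true → f x ≤ b → ∃ λ v → S v ≡ true × (∀ y → S y ≡ true → f v ≤ f y)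
  go b x Sx fx≤b with Fin.any? (λ y → (S y Bool.≟ true) ×-dec (f y <? f x))
  ... | no ∄y = x , Sx , λ y Sy → ≮⇒≥ λ fy<fx → ∄y (y , Sy , fy<fx)
  go zero    x Sx fx≤b | yes (y , Sy , fy<fx) = ⊥-elim (n≮0 (≤-trans fy<fx fx≤b))
  go (suc b) x Sx fx≤b | yes (y , Sy , fy<fx) = go b y Sy (≤-pred (≤-trans fy<fx fx≤b))

-- Greedy packing of cliques

Clique : (a : Fin n → Fin n → Bool) → (Fin n → Bool) → Set
Clique a Q = ∀ x y → x ≢ y → Q x ≡ true → Q y ≡ true → a x y ≡ true

Independent : (a : Fin n → Fin n → Bool) → (Fin n → Bool) → Set
Independent a I = ∀ x y → I x ≡ true → I y ≡ true → a x y ≡ false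

TriangleFree : (a : Fin n → Fin n → Bool) → (Fin n → Bool) → Set
TriangleFree a R = ∀ x y z → R x ≡ true → R y ≡ true → R z ≡ true →
                   a x y ≡ true → a x z ≡ true → a y z ≡ false

record IsGraphOn (a : Fin n → Fin n → Bool) (V : Fin n → Bool) : Set where
  field
    adj-sym    : ∀ x y → a x y ≡ a y x
    adj-irrefl : ∀ x → a x x ≡ false
    adj-⊆      : ∀ x → a x ⊆ V

module Packing {n} {a : Fin n → Fin n → Bool} {V} (G : IsGraphOn a V) where
  open IsGraphOn G

  -- The witness is a `Subset` rather than a Boolean function, so that `anySubset?` decides its
  -- existence.
  HasClique : (Fin n → Bool) → ℕ → Set
  HasClique R k = ∃ λ (Q : Subset n) → lookup Q ⊆ R × Clique a (lookup Q) × ∣ lookup Q ∣ ≡ k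

  hasClique? : ∀ R k → Dec (HasClique R k)
  hasClique? R k = anySubset? λ Q →
    (Fin.all? λ x → (lookup Q x Bool.≟ true) →-dec (R x Bool.≟ true)) ×-dec
    ((Fin.all? λ x → Fin.all? λ y → ¬? (x Fin.≟ y) →-dec
       ((lookup Q x Bool.≟ true) →-dec ((lookup Q y Bool.≟ true) →-dec (a x y Bool.≟ true)))) ×-dec
     (∣ lookup Q ∣ ≟ k))

  hasClique : ∀ {R k} Q → Q ⊆ R → Clique a Q → ∣ Q ∣ ≡ k → HasClique R k
  hasClique {R} {k} Q Q⊆R clq size = tabulate Q ,
    (λ x → Q⊆R x ∘ trans (sym (at x))) ,
    (λ x y x≢y Qx Qy → clq x y x≢y (trans (sym (at x)) Qx) (trans (sym (at y)) Qy)) ,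
    trans (sum-cong-≗ (cong [_] ∘ at)) size
    where
    at = lookup∘tabulate Q

  -- Adjacency to all of `Q` puts `x` outside `Q`, by irreflexivity, so the size grows by exactly
  -- one.
  insert : ∀ {R} x {Q} → R x ≡ true → (∀ y → Q y ≡ true → a x y ≡ true) →
           Q ⊆ R → Clique a Q → ∣ Q ∣ ≡ k →
           let Q′ = λ w → δ x w ∨ Q w in Q′ ⊆ R × Clique a Q′ × ∣ Q′ ∣ ≡ suc k
  insert {k = k} {R} x {Q} Rx x~Q Q⊆R clq size = sub , clq′ , size′
    where
    sub : (λ w → δ x w ∨ Q w) ⊆ R
    sub w eq with x Fin.≟ w
    ... | yes refl = Rx
    ... | no _     = Q⊆R w eq
    clq′ : Clique a (λ w → δ x w ∨ Q w)
    clq′ y z y≢z Q′y Q′z with x Fin.≟ y | x Fin.≟ z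
    ... | yes refl | yes refl = ⊥-elim (y≢z refl)
    ... | yes refl | no _     = x~Q z Q′z
    ... | no _     | yes refl = trans (adj-sym y z) (x~Q y Q′y)
    ... | no _     | no _     = clq y z y≢z Q′y Q′z
    disjoint : ∀ w → [ δ x w ∨ Q w ] ≡ [ δ x w ] + [ Q w ]
    disjoint w with x Fin.≟ w | Q w in eq
    ... | yes refl | true  = ⊥-elim (true≢false (x~Q x eq) (adj-irrefl x))
    ... | yes refl | false = refl
    ... | no _     | _     = refl
    size′ : ∣ (λ w → δ x w ∨ Q w) ∣ ≡ suc k
    size′ = trans (sum-cong-≗ disjoint)
            (trans (∑-distrib-+ (λ w → [ δ x w ]) (λ w → [ Q w ])) (cong₂ _+_ (∣δ∣ x) size))

  singleton : ∀ {R} x → R x ≡ true → δ x ⊆ R × Clique a (δ x) × ∣ δ x ∣ ≡ 1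
  singleton {R} x Rx = (λ w eq → subst (λ w → R w ≡ true) (δ-≡ eq) Rx) ,
    (λ y z y≢z δy δz → ⊥-elim (y≢z (trans (sym (δ-≡ {x = x} δy)) (δ-≡ δz)))) , ∣δ∣ x

  pair : ∀ {R} x y → R x ≡ true → R y ≡ true → a x y ≡ true →
         let Q = λ w → δ x w ∨ δ y w in Q ⊆ R × Clique a Q × ∣ Q ∣ ≡ 2
  pair x y Rx Ry axy with singleton y Ry
  ... | sub , clq , size =
    insert x Rx (λ w eq → subst (λ w → a x w ≡ true) (δ-≡ eq) axy) sub clq size

  no-1-clique : ∀ {R} → ¬ HasClique R 1 → ∀ x → R x ≡ false
  no-1-clique none x = ≡false λ Rx →
    let sub , clq , size = singleton x Rx in none (hasClique (δ x) sub clq size)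

  no-2-clique : ∀ {R} → ¬ HasClique R 2 → Independent a R
  no-2-clique none x y Rx Ry = ≡false λ axy →
    let sub , clq , size = pair x y Rx Ry axy in none (hasClique _ sub clq size)

  no-3-clique : ∀ {R} → ¬ HasClique R 3 → TriangleFree a R
  no-3-clique none x y z Rx Ry Rz axy axz = ≡false λ ayz →
    let sub , clq , size = pair y z Ry Rz ayz
        sub′ , clq′ , size′ = insert x Rx (x~ axy axz) sub clq size
    in none (hasClique _ sub′ clq′ size′)
    where
    x~ : a x y ≡ true → a x z ≡ true → ∀ w → δ y w ∨ δ z w ≡ true → a x w ≡ true
    x~ axy axz w eq with y Fin.≟ w | z Fin.≟ w
    ... | yes refl | _        = axy
    ... | no _     | yes refl = axz

  -- The equation `covers` between indicators says at once that the parts and `rest` are pairwise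
  -- disjoint and that their union is `S`.
  record MaximalPacking (S : Fin n → Bool) (k : ℕ) : Set where
    field
      count     : ℕ
      parts     : Fin count → Fin n → Bool
      rest      : Fin n → Bool
      covers    : ∀ w → (sum λ i → [ parts i w ]) + [ rest w ] ≡ [ S w ]
      cliques   : ∀ i → Clique a (parts i)
      sizes     : ∀ i → ∣ parts i ∣ ≡ k
      exhausted : ¬ HasClique rest k

    rest⊆ : rest ⊆ S
    rest⊆ w rw = []-positive (≤-trans (≤-reflexive (sym ([]-true rw)))
                   (≤-trans (m≤n+m _ _) (≤-reflexive (covers w))))

    size-eq : count * k + ∣ rest ∣ ≡ ∣ S ∣
    size-eq = begin
      count * k + ∣ rest ∣
        ≡⟨ cong (_+ ∣ rest ∣) (sum-const count k) ⟨
      sum (const {B = Fin count} k) + ∣ rest ∣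
        ≡⟨ cong (_+ ∣ rest ∣) (sum-cong-≗ sizes) ⟨
      (sum λ i → ∣ parts i ∣) + ∣ rest ∣
        ≡⟨ cong (_+ ∣ rest ∣) (∑-comm (λ i w → [ parts i w ])) ⟩
      (sum λ w → sum λ i → [ parts i w ]) + ∣ rest ∣
        ≡⟨ ∑-distrib-+ (λ w → sum λ i → [ parts i w ]) (λ w → [ rest w ]) ⟨
      (sum λ w → (sum λ i → [ parts i w ]) + [ rest w ])
        ≡⟨ sum-cong-≗ covers ⟩
      ∣ S ∣ ∎
      where open ≡-Reasoning

  -- Greedy choice: take out a `k`-clique as long as there is one. Since `1 ≤ k`, the remaining set
  -- shrinks strictly.
  pack : ∀ S k → 1 ≤ k → MaximalPacking S k
  pack S k 1≤k = go ∣ S ∣ S ≤-refl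
    where
    go : ∀ b S → ∣ S ∣ ≤ b → MaximalPacking S k
    go b S S≤b with hasClique? S k
    ... | no none = record
      { count = 0 ; parts = λ () ; rest = S ; covers = λ _ → refl
      ; cliques = λ () ; sizes = λ () ; exhausted = none }
    ... | yes (Q , Q⊆S , clq , size) = extend b S≤b
      where
      S′ : Fin n → Bool
      S′ w = S w ∧ not (lookup Q w)
      split : ∀ w → [ lookup Q w ] + [ S′ w ] ≡ [ S w ]
      split w with lookup Q w in q | S w in s
      ... | true  | true  = refl
      ... | true  | false = ⊥-elim (true≢false (Q⊆S w q) s)
      ... | false | true  = refl
      ... | false | false = refl
      shrinks : k + ∣ S′ ∣ ≡ ∣ S ∣
      shrinks = trans (cong (_+ ∣ S′ ∣) (sym size))
        (trans (sym (∑-distrib-+ (λ w → [ lookup Q w ]) (λ w → [ S′ w ]))) (sum-cong-≗ split))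
      smaller : suc ∣ S′ ∣ ≤ ∣ S ∣
      smaller = ≤-trans (+-monoˡ-≤ ∣ S′ ∣ 1≤k) (≤-reflexive shrinks)
      extend : ∀ b → ∣ S ∣ ≤ b → MaximalPacking S k
      extend zero    S≤b = ⊥-elim (n≮0 (≤-trans smaller S≤b))
      extend (suc b) S≤b = record
        { count = suc count
        ; parts = λ { zero → lookup Q ; (suc i) → parts i }
        ; rest = rest
        ; covers = λ w → trans (+-assoc [ lookup Q w ] _ _)
                           (trans (cong ([ lookup Q w ] +_) (covers w)) (split w))
        ; cliques = λ { zero → clq ; (suc i) → cliques i }
        ; sizes = λ { zero → size ; (suc i) → sizes i }
        ; exhausted = exhausted }
        where open MaximalPacking (go b S′ (≤-pred (≤-trans smaller S≤b)))

-- Splitting a neighbourhood into few cliques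

-- The bound 3 on the parts limits how many edges a surviving vertex can lose when `v` is removed
-- (`lost-step`).
NeighbourhoodPartition : (a : Fin n → Fin n → Bool) → Fin n → ℕ → Set
NeighbourhoodPartition {n} a v p = ∃ λ (P : Fin p → Fin n → Bool) →
  (∀ w → (sum λ i → [ P i w ]) ≡ [ a v w ]) × (∀ i → Clique a (P i)) × (∀ i → ∣ P i ∣ ≤ 3)

two-members : (Q : Fin n → Bool) → ∣ Q ∣ ≡ 2 →
              ∃₂ λ x y → x ≢ y × Q x ≡ true × Q y ≡ true
two-members Q size with sum-positive (λ x → [ Q x ]) (≤-trans (s≤s z≤n) (≤-reflexive (sym size)))
... | x , 1≤Qx with Fin.any? (λ y → (Q y Bool.≟ true) ×-dec ¬? (x Fin.≟ y))
...   | yes (y , Qy , x≢y) = x , y , x≢y , []-positive 1≤Qx , Qy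
...   | no none = ⊥-elim (<⇒≱ (s≤s (s≤s z≤n)) (≤-trans (≤-reflexive (sym size))
                    (≤-trans (∣∣-mono Q⊆δ) (≤-reflexive (∣δ∣ x)))))
  where
  Q⊆δ : Q ⊆ δ x
  Q⊆δ y Qy with x Fin.≟ y
  ... | yes _  = refl
  ... | no x≢y = ⊥-elim (none (y , Qy , x≢y))

module Neighbourhood {n} {a : Fin n → Fin n → Bool} {V} (G : IsGraphOn a V) where
  open IsGraphOn G
  open Packing G

  degree≤ : ∀ x → ∣ a x ∣ ≤ ∣ V ∣
  degree≤ x = ∣∣-mono (adj-⊆ x)

  -- The neighbours of `x` lie in `V` outside `I`.
  independent-degree : ∀ {I} → I ⊆ V → Independent a I → ∀ {x} → I x ≡ true →
                       ∣ I ∣ + ∣ a x ∣ ≤ ∣ V ∣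
  independent-degree {I} I⊆V ind {x} Ix = ≤-trans
    (≤-reflexive (sym (∑-distrib-+ (λ w → [ I w ]) (λ w → [ a x w ]))))
    (sum-mono λ w → []-disjoint (I⊆V w) (adj-⊆ x w) (ind x w Ix))

  -- A vertex of `R` is adjacent to at most one of `x` and `y`, so the left side counts each vertex
  -- of `V` at most twice.
  triangleFree-degree : ∀ {R} → R ⊆ V → TriangleFree a R →
    ∀ {x y} → R x ≡ true → R y ≡ true → a x y ≡ true →
    ∣ a x ∣ + ∣ a y ∣ + ∣ R ∣ ≤ ∣ V ∣ + ∣ V ∣
  triangleFree-degree {R} R⊆V free {x} {y} Rx Ry axy = begin
    ∣ a x ∣ + ∣ a y ∣ + ∣ R ∣
      ≡⟨ cong (_+ ∣ R ∣) (∑-distrib-+ (λ w → [ a x w ]) (λ w → [ a y w ])) ⟨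
    (sum λ w → [ a x w ] + [ a y w ]) + ∣ R ∣
      ≡⟨ ∑-distrib-+ (λ w → [ a x w ] + [ a y w ]) (λ w → [ R w ]) ⟨
    (sum λ w → [ a x w ] + [ a y w ] + [ R w ])
      ≤⟨ sum-mono pointwise ⟩
    (sum λ w → [ V w ] + [ V w ])
      ≡⟨ ∑-distrib-+ (λ w → [ V w ]) (λ w → [ V w ]) ⟩
    ∣ V ∣ + ∣ V ∣ ∎
    where
    open ≤-Reasoning
    pointwise : ∀ w → [ a x w ] + [ a y w ] + [ R w ] ≤ [ V w ] + [ V w ]
    pointwise w with R w in r
    ... | false rewrite +-identityʳ ([ a x w ] + [ a y w ]) =
      +-mono-≤ ([]-mono (adj-⊆ x w)) ([]-mono (adj-⊆ y w))
    ... | true rewrite R⊆V w r = +-monoˡ-≤ 1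
      ([]-disjoint {d = true} (λ _ → refl) (λ _ → refl) (free x y w Rx Ry r axy))

  -- N(v) is packed with triangles, which leaves the triangle-free `R`; then `R` is packed with
  -- edges, which leaves the independent `I`, whose vertices become singleton parts. `R-edge`
  -- retains an edge inside `R` to which `triangleFree-degree` can be applied.
  record GreedySplit (v : Fin n) : Set where
    field
      triangles edges : ℕ
      R I             : Fin n → Bool
      R⊆N             : R ⊆ a v
      I⊆R             : I ⊆ R
      R-triangleFree  : TriangleFree a R
      I-independent   : Independent a I
      R-size          : triangles * 3 + ∣ R ∣ ≡ ∣ a v ∣
      I-size          : edges * 2 + ∣ I ∣ ≡ ∣ R ∣
      R-edge          : 1 ≤ edges → ∃₂ λ x y → R x ≡ true × R y ≡ true × a x y ≡ true
      partition       : NeighbourhoodPartition a v (triangles + edges + ∣ I ∣)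

    count : ℕ
    count = triangles + edges + ∣ I ∣

    I⊆V : I ⊆ V
    I⊆V x Ix = adj-⊆ v x (R⊆N x (I⊆R x Ix))

  abstract
    greedySplit : ∀ v → GreedySplit v
    greedySplit v = record
      { triangles = A.count ; edges = B.count ; R = A.rest ; I = B.rest
      ; R⊆N = A.rest⊆ ; I⊆R = B.rest⊆
      ; R-triangleFree = no-3-clique A.exhausted
      ; I-independent = no-2-clique B.exhausted
      ; R-size = A.size-eq ; I-size = B.size-eq
      ; R-edge = edge B.count B.parts B.covers B.cliques B.sizes
      ; partition = subst (NeighbourhoodPartition a v) (cong (A.count + B.count +_) C-count)
          ( P , covers
          , all-++ (Clique a) (A.parts ++ B.parts) C.parts
              (all-++ (Clique a) A.parts B.parts A.cliques B.cliques) C.cliques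
          , all-++ (λ Q → ∣ Q ∣ ≤ 3) (A.parts ++ B.parts) C.parts
              (all-++ (λ Q → ∣ Q ∣ ≤ 3) A.parts B.parts
                (λ i → ≤-reflexive (A.sizes i))
                (λ i → ≤-trans (≤-reflexive (B.sizes i)) (s≤s (s≤s z≤n))))
              (λ i → ≤-trans (≤-reflexive (C.sizes i)) (s≤s z≤n)) )
      }
      where
      module A = MaximalPacking (pack (a v) 3 (s≤s z≤n))
      module B = MaximalPacking (pack A.rest 2 (s≤s z≤n))
      -- Packing with 1-cliques turns `I` into singleton parts and leaves nothing over.
      module C = MaximalPacking (pack B.rest 1 (s≤s z≤n))

      C-empty : ∀ w → [ C.rest w ] ≡ 0
      C-empty w = []-false (no-1-clique C.exhausted w)

      C-count : C.count ≡ ∣ B.rest ∣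
      C-count = trans (sym (trans (cong₂ _+_ (*-identityʳ C.count) (sum-zero C-empty))
                                  (+-identityʳ C.count))) C.size-eq

      P : Fin (A.count + B.count + C.count) → Fin n → Bool
      P = (A.parts ++ B.parts) ++ C.parts

      covers : ∀ w → (sum λ i → [ P i w ]) ≡ [ a v w ]
      covers w = begin
        sum (on-w ∘ P)
          ≡⟨ sum-++ on-w (A.parts ++ B.parts) C.parts ⟩
        sum (on-w ∘ (A.parts ++ B.parts)) + sum (on-w ∘ C.parts)
          ≡⟨ cong₂ _+_ (sum-++ on-w A.parts B.parts)
               (trans (sym (+-identityʳ _)) (cong (sum (on-w ∘ C.parts) +_) (sym (C-empty w)))) ⟩
        sum (on-w ∘ A.parts) + sum (on-w ∘ B.parts) + (sum (on-w ∘ C.parts) + [ C.rest w ])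
          ≡⟨ cong (sum (on-w ∘ A.parts) + sum (on-w ∘ B.parts) +_) (C.covers w) ⟩
        sum (on-w ∘ A.parts) + sum (on-w ∘ B.parts) + [ B.rest w ]
          ≡⟨ +-assoc (sum (on-w ∘ A.parts)) _ _ ⟩
        sum (on-w ∘ A.parts) + (sum (on-w ∘ B.parts) + [ B.rest w ])
          ≡⟨ cong (sum (on-w ∘ A.parts) +_) (B.covers w) ⟩
        sum (on-w ∘ A.parts) + [ A.rest w ]
          ≡⟨ A.covers w ⟩
        [ a v w ] ∎
        where
        open ≡-Reasoning
        on-w : (Fin n → Bool) → ℕ
        on-w Q = [ Q w ]

      edge : ∀ p (Q : Fin p → Fin n → Bool) →
             (∀ w → (sum λ i → [ Q i w ]) + [ B.rest w ] ≡ [ A.rest w ]) →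
             (∀ i → Clique a (Q i)) → (∀ i → ∣ Q i ∣ ≡ 2) →
             1 ≤ p → ∃₂ λ x y → A.rest x ≡ true × A.rest y ≡ true × a x y ≡ true
      edge (suc p) Q cov clq size _ with two-members (Q zero) (size zero)
      ... | x , y , x≢y , Qx , Qy = x , y , inR x Qx , inR y Qy , clq zero x y x≢y Qx Qy
        where
        inR : Q zero ⊆ A.rest
        inR w Qw = []-positive (≤-trans (≤-reflexive (sym ([]-true Qw)))
          (≤-trans (term≤sum (λ i → [ Q i w ]) zero)
          (≤-trans (m≤m+n _ _) (≤-reflexive (cov w)))))

  -- Here `d` is a lower bound for all degrees that `v` need not attain: the estimates are applied
  -- both at a vertex of minimum degree and at a second vertex.
  module MinDegree (d : ℕ) (d≤ : ∀ x → V x ≡ true → d ≤ ∣ a x ∣)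
                   (v : Fin n) (Vv : V v ≡ true) (S : GreedySplit v) where
    open GreedySplit S

    R⊆V : R ⊆ V
    R⊆V x Rx = adj-⊆ v x (R⊆N x Rx)

    d≤∣V∣ : d ≤ ∣ V ∣
    d≤∣V∣ = ≤-trans (d≤ v Vv) (degree≤ v)

    ∣I∣+d≤∣V∣ : ∣ I ∣ + d ≤ ∣ V ∣
    ∣I∣+d≤∣V∣ with ∣ I ∣ in eq
    ... | zero  = d≤∣V∣
    ... | suc _ with sum-positive (λ x → [ I x ]) (≤-trans (s≤s z≤n) (≤-reflexive (sym eq)))
    ...   | x , 1≤Ix = let Ix = []-positive 1≤Ix in
      ≤-trans (≤-reflexive (cong (_+ d) (sym eq)))
      (≤-trans (+-monoʳ-≤ ∣ I ∣ (d≤ x (I⊆V x Ix))) (independent-degree I⊆V I-independent Ix))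

    count≤degree : count ≤ ∣ a v ∣
    count≤degree = begin
      triangles + edges + ∣ I ∣
        ≤⟨ +-monoˡ-≤ ∣ I ∣ (+-mono-≤ (m≤m*n triangles 3) (m≤m*n edges 2)) ⟩
      triangles * 3 + edges * 2 + ∣ I ∣   ≡⟨ +-assoc (triangles * 3) _ _ ⟩
      triangles * 3 + (edges * 2 + ∣ I ∣) ≡⟨ cong (triangles * 3 +_) I-size ⟩
      triangles * 3 + ∣ R ∣               ≡⟨ R-size ⟩
      ∣ a v ∣                             ∎
      where open ≤-Reasoning

    degree-eq : ∣ a v ∣ ≡ triangles * 3 + (edges * 2 + ∣ I ∣)
    degree-eq = trans (sym R-size) (cong (triangles * 3 +_) (sym I-size))

    -- As 2t ≤ 3t for the t triangles, twice the count is at most deg v + |I|, and |I| ≤ |V| - d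
    -- because a vertex of `I` has all its neighbours outside `I`.
    2count : 2 * count + d ≤ ∣ a v ∣ + ∣ V ∣
    2count rewrite degree-eq = begin
      2 * count + d
        ≡⟨ e₁ triangles edges ∣ I ∣ d ⟩
      triangles * 2 + edges * 2 + ∣ I ∣ + (∣ I ∣ + d)
        ≤⟨ +-mono-≤ (+-monoˡ-≤ ∣ I ∣ (+-monoˡ-≤ (edges * 2) (*-monoʳ-≤ triangles (s≤s (s≤s z≤n))))) ∣I∣+d≤∣V∣ ⟩
      triangles * 3 + edges * 2 + ∣ I ∣ + ∣ V ∣
        ≡⟨ cong (_+ ∣ V ∣) (+-assoc (triangles * 3) (edges * 2) ∣ I ∣) ⟩
      triangles * 3 + (edges * 2 + ∣ I ∣) + ∣ V ∣ ∎
      where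
      open ≤-Reasoning
      e₁ : ∀ t m i d → 2 * (t + m + i) + d ≡ t * 2 + m * 2 + i + (i + d)
      e₁ = solve-∀

    -- If the packing of `R` uses an edge, `triangleFree-degree` applies to an edge of `R`;
    -- otherwise |R| = |I|.
    R-bound : edges * 2 + ∣ I ∣ + 2 * d ≤ 2 * ∣ V ∣
    R-bound with edges in eq | R-edge
    ... | zero  | _ = ≤-trans (≤-reflexive (e₁ ∣ I ∣ d))
                     (≤-trans (+-mono-≤ ∣I∣+d≤∣V∣ d≤∣V∣) (≤-reflexive (e₂ ∣ V ∣)))
      where
      e₁ : ∀ i d → i + 2 * d ≡ (i + d) + d
      e₁ = solve-∀
      e₂ : ∀ n → n + n ≡ 2 * n
      e₂ = solve-∀
    ... | suc m | edge with edge (s≤s z≤n)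
    ...   | x , y , Rx , Ry , axy = begin
      suc m * 2 + ∣ I ∣ + 2 * d        ≡⟨ cong (λ m → m * 2 + ∣ I ∣ + 2 * d) eq ⟨
      edges * 2 + ∣ I ∣ + 2 * d        ≡⟨ cong (_+ 2 * d) I-size ⟩
      ∣ R ∣ + 2 * d                    ≡⟨ e₁ ∣ R ∣ d ⟩
      d + d + ∣ R ∣                    ≤⟨ +-monoˡ-≤ ∣ R ∣ (+-mono-≤ (d≤ x (R⊆V x Rx)) (d≤ y (R⊆V y Ry))) ⟩
      ∣ a x ∣ + ∣ a y ∣ + ∣ R ∣        ≤⟨ triangleFree-degree R⊆V R-triangleFree Rx Ry axy ⟩
      ∣ V ∣ + ∣ V ∣                    ≡⟨ e₂ ∣ V ∣ ⟩
      2 * ∣ V ∣                        ∎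
      where
      open ≤-Reasoning
      e₁ : ∀ r d → r + 2 * d ≡ d + d + r
      e₁ = solve-∀
      e₂ : ∀ n → n + n ≡ 2 * n
      e₂ = solve-∀

    -- Six times the count equals 2 deg v + |R| + 3|I|, and `R-bound` estimates |R|. If deg v = d, a
    -- count close to |V|/2 therefore forces |I| to be about |V|/3 or more.
    6count : 6 * count + 2 * d ≤ 2 * ∣ a v ∣ + 2 * ∣ V ∣ + 3 * ∣ I ∣
    6count rewrite degree-eq = from-combination R-bound (e triangles edges (∣ I ∣) d (∣ V ∣))
      where
      e : ∀ t m i d n → 6 * (t + m + i) + 2 * d + 2 * n ≡
          2 * (t * 3 + (m * 2 + i)) + 2 * n + 3 * i + (m * 2 + i + 2 * d)
      e = solve-∀

-- Clique partitions and the removal of a vertex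

-- On non-edges the count is 0, so that every member is a clique.
PartitionsInto : (a : Fin n → Fin n → Bool) → ℕ → Set
PartitionsInto {n} a k = ∃ λ (F : Fin k → Fin n → Bool) →
  ∀ u w → u ≢ w → (sum λ i → [ F i u ∧ F i w ]) ≡ [ a u w ]

_∖_ : (Fin n → Bool) → Fin n → Fin n → Bool
(V ∖ v) w = V w ∧ not (δ v w)

∣∖∣ : (V : Fin n → Bool) → ∀ {v} → V v ≡ true → suc ∣ V ∖ v ∣ ≡ ∣ V ∣
∣∖∣ V {v} Vv = begin
  suc ∣ V ∖ v ∣                    ≡⟨ cong (_+ ∣ V ∖ v ∣) (∣δ∣ v) ⟨
  ∣ δ v ∣ + ∣ V ∖ v ∣              ≡⟨ ∑-distrib-+ (λ w → [ δ v w ]) (λ w → [ (V ∖ v) w ]) ⟨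
  (sum λ w → [ δ v w ] + [ (V ∖ v) w ]) ≡⟨ sum-cong-≗ pointwise ⟩
  ∣ V ∣                            ∎
  where
  open ≡-Reasoning
  pointwise : ∀ w → [ δ v w ] + [ (V ∖ v) w ] ≡ [ V w ]
  pointwise w with v Fin.≟ w
  ... | no _ = cong [_] (Bool.∧-identityʳ (V w))
  ... | yes refl rewrite Vv = refl

-- `g` is the original graph and `a` what is left of it on the surviving vertices `V`. Edges to
-- removed vertices do not count as lost.
lost : (g a : Fin n → Fin n → Bool) (V : Fin n → Bool) → Fin n → Fin n → Bool
lost g a V x w = g x w ∧ (V w ∧ not (a x w))

-- Removing v: every part Q of N(v) yields the member Q ∪ {v}, and the edges
-- inside Q disappear together with v.
module Removal {n} {a : Fin n → Fin n → Bool} {V} (G : IsGraphOn a V)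
               (v : Fin n) {p} (N : NeighbourhoodPartition a v p) where
  open IsGraphOn G

  P       = proj₁ N
  covers  = proj₁ (proj₂ N)
  cliques = proj₁ (proj₂ (proj₂ N))
  small   = proj₂ (proj₂ (proj₂ N))

  P⁺ : Fin p → Fin n → Bool
  P⁺ i w = δ v w ∨ P i w

  used : Fin n → Fin n → ℕ
  used u w = sum λ i → [ P⁺ i u ∧ P⁺ i w ]

  b : Fin n → Fin n → Bool
  b u w = a u w ∧ (used u w ≡ᵇ 0)

  used-comm : ∀ u w → used u w ≡ used w u
  used-comm u w = sum-cong-≗ λ i → cong [_] (Bool.∧-comm (P⁺ i u) (P⁺ i w))

  used-v : ∀ {w} → v ≢ w → used v w ≡ [ a v w ]
  used-v {w} v≢w = trans (sum-cong-≗ at) (covers w)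
    where
    at : ∀ i → [ P⁺ i v ∧ P⁺ i w ] ≡ [ P i w ]
    at i rewrite δ-refl v | δ-≢ v≢w = refl

  inside : Fin n → Fin n → ℕ
  inside u w = sum λ i → [ P i u ∧ P i w ]

  used-≢ : ∀ {u w} → v ≢ u → v ≢ w → used u w ≡ inside u w
  used-≢ {u} {w} v≢u v≢w rewrite δ-≢ v≢u | δ-≢ v≢w = refl

  inside≤ : ∀ {u w} → u ≢ w → inside u w ≤ [ a u w ]
  inside≤ {u} {w} u≢w with a u w in eq
  ... | true  = ≤-trans (sum-mono {p} λ i → []-mono {P i u ∧ P i w} (proj₁ ∘ ∧-true))
                  (≤-trans (≤-reflexive (covers u)) ([]≤1 (a v u)))
  ... | false = ≤-reflexive (sum-zero {p} λ i → []-false (≡false λ both →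
                  let Pu , Pw = ∧-true both in true≢false (cliques i u w u≢w Pu Pw) eq))

  used≤ : ∀ {u w} → u ≢ w → used u w ≤ [ a u w ]
  used≤ {u} {w} u≢w = by-cases (v Fin.≟ u) (v Fin.≟ w)
    where
    by-cases : Dec (v ≡ u) → Dec (v ≡ w) → used u w ≤ [ a u w ]
    by-cases (yes refl) _          = ≤-reflexive (used-v u≢w)
    by-cases (no v≢u)   (yes refl) = ≤-reflexive (trans (used-comm u w)
                                       (trans (used-v v≢u) (cong [_] (adj-sym w u))))
    by-cases (no v≢u)   (no v≢w)   = ≤-trans (≤-reflexive (used-≢ v≢u v≢w)) (inside≤ u≢w)

  used+b : ∀ {u w} → u ≢ w → used u w + [ b u w ] ≡ [ a u w ]
  used+b {u} {w} u≢w = complement (used u w) (a u w) (used≤ u≢w)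
    where
    complement : ∀ k c → k ≤ [ c ] → k + [ c ∧ (k ≡ᵇ 0) ] ≡ [ c ]
    complement zero    c    _         = cong [_] (Bool.∧-identityʳ c)
    complement (suc 0) true _         = refl
    complement (suc (suc _)) true (s≤s ())

  extend : PartitionsInto b k → PartitionsInto a (p + k)
  extend (F , eqs) = P⁺ ++ F , λ u w u≢w →
    trans (sum-++ (λ Q → [ Q u ∧ Q w ]) P⁺ F)
          (trans (cong (used u w +_) (eqs u w u≢w)) (used+b u≢w))

  b⊆a : ∀ {u w} → b u w ≡ true → a u w ≡ true
  b⊆a = proj₁ ∘ ∧-true

  -- Each neighbour of `v` lies in some part, so the new members use up every edge at `v`.
  b-isolates-v : ∀ w → b w v ≡ false
  b-isolates-v w = ≡false λ bwv → isolated (w Fin.≟ v) bwv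
    where
    isolated : Dec (w ≡ v) → b w v ≡ true → ⊥
    isolated (yes refl) bwv = true≢false (b⊆a bwv) (adj-irrefl v)
    isolated (no w≢v)   bwv = 1+n≢n (trans
      (trans (cong suc (sym (trans (used-comm w v) (trans (used-v (w≢v ∘ sym))
               (trans (cong [_] (adj-sym v w)) ([]-true (b⊆a bwv)))))))
             (trans (+-comm 1 _) (cong (used w v +_) (sym ([]-true bwv)))))
      (trans (used+b w≢v) ([]-true (b⊆a bwv))))

  graph : IsGraphOn b (V ∖ v)
  graph = record
    { adj-sym    = λ x y → cong₂ (λ e k → e ∧ (k ≡ᵇ 0)) (adj-sym x y) (used-comm x y)
    ; adj-irrefl = λ x → ≡false λ bxx → true≢false (b⊆a bxx) (adj-irrefl x)
    ; adj-⊆      = λ x w bxw → cong₂ (λ s t → s ∧ not t) (adj-⊆ x w (b⊆a bxw)) (≢v x w bxw)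
    }
    where
    ≢v : ∀ x w → b x w ≡ true → δ v w ≡ false
    ≢v x w bxw = ≡false λ eq → true≢false
      (subst (λ w → b x w ≡ true) (sym (δ-≡ eq)) bxw) (b-isolates-v x)

  -- The vertex `x` lies in at most one part, and newly lost edges at `x` stay inside that part,
  -- which has at most 3 vertices.
  lost-step : ∀ (g : Fin n → Fin n → Bool) {x} → (V ∖ v) x ≡ true →
              ∣ lost g b (V ∖ v) x ∣ ≤ ∣ lost g a V x ∣ + 3
  lost-step g {x} V∖vx = begin
    ∣ lost g b (V ∖ v) x ∣
      ≤⟨ sum-mono pointwise ⟩
    (sum λ w → [ lost g a V x w ] + inside x w)
      ≡⟨ ∑-distrib-+ (λ w → [ lost g a V x w ]) (inside x) ⟩
    ∣ lost g a V x ∣ + sum (inside x)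
      ≡⟨ cong (∣ lost g a V x ∣ +_) (∑-comm (λ w i → [ P i x ∧ P i w ])) ⟩
    ∣ lost g a V x ∣ + (sum λ i → ∣ (λ w → P i x ∧ P i w) ∣)
      ≤⟨ +-monoʳ-≤ ∣ lost g a V x ∣ (sum-mono at-part) ⟩
    ∣ lost g a V x ∣ + (sum λ i → [ P i x ] * 3)
      ≡⟨ cong (∣ lost g a V x ∣ +_) (sym (*-distribʳ-sum 3 (λ i → [ P i x ]))) ⟩
    ∣ lost g a V x ∣ + (sum λ i → [ P i x ]) * 3
      ≡⟨ cong (λ k → ∣ lost g a V x ∣ + k * 3) (covers x) ⟩
    ∣ lost g a V x ∣ + [ a v x ] * 3
      ≤⟨ +-monoʳ-≤ ∣ lost g a V x ∣ (*-monoˡ-≤ 3 ([]≤1 (a v x))) ⟩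
    ∣ lost g a V x ∣ + 3 ∎
    where
    open ≤-Reasoning
    v≢ : ∀ {w} → (V ∖ v) w ≡ true → v ≢ w
    v≢ {w} eq refl with V v | δ-refl v
    ... | true | δ-refl rewrite δ-refl with () ← eq
    at-part : ∀ i → ∣ (λ w → P i x ∧ P i w) ∣ ≤ [ P i x ] * 3
    at-part i with P i x
    ... | true  = small i
    ... | false = ≤-reflexive (sum-zero {n} λ _ → refl)
    pointwise : ∀ w → [ lost g b (V ∖ v) x w ] ≤ [ lost g a V x w ] + inside x w
    pointwise w with lost g b (V ∖ v) x w in l
    ... | false = z≤n
    ... | true with ∧-true {g x w} l
    ...   | gxw , rest with ∧-true {(V ∖ v) w} rest
    ...     | V∖vw , nb with a x w in axw
    ...       | false rewrite gxw | proj₁ (∧-true {V w} V∖vw) = s≤s z≤n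
    ...       | true = ≤-trans (positive (used x w) nb)
                         (≤-trans (≤-reflexive (used-≢ (v≢ V∖vx) (v≢ V∖vw))) (m≤n+m _ _))
      where
      positive : ∀ k → not (k ≡ᵇ 0) ≡ true → 1 ≤ k
      positive (suc _) _ = s≤s z≤n

-- The interface of one removal; `remove` is abstract, so the new graph `b` stays opaque in the
-- inductions below.
record Reduction {n} (a : Fin n → Fin n → Bool) (V : Fin n → Bool) (v : Fin n) (p : ℕ) : Set where
  field
    b         : Fin n → Fin n → Bool
    graph     : IsGraphOn b (V ∖ v)
    b⊆a       : ∀ {x y} → b x y ≡ true → a x y ≡ true
    extend    : ∀ {k} → PartitionsInto b k → PartitionsInto a (p + k)
    lost-step : ∀ (g : Fin n → Fin n → Bool) {x} → (V ∖ v) x ≡ true →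
                ∣ lost g b (V ∖ v) x ∣ ≤ ∣ lost g a V x ∣ + 3

abstract
  remove : ∀ {a : Fin n → Fin n → Bool} {V} → IsGraphOn a V → ∀ {v p} →
           NeighbourhoodPartition a v p → Reduction a V v p
  remove G {v} N = record
    { b = b ; graph = graph ; b⊆a = b⊆a ; extend = extend ; lost-step = lost-step }
    where open Removal G v N

-- Clique partitions with at most ⌊n²/4⌋ members

empty-graph : ∀ {a : Fin n → Fin n → Bool} {V} → IsGraphOn a V → ∣ V ∣ ≡ 0 → PartitionsInto a 0
empty-graph {n} {a} {V} G V≡0 = (λ ()) , λ u w _ → sym ([]-false (≡false λ auw →
  1+n≰n (≤-trans (≤-reflexive (sym ([]-true (IsGraphOn.adj-⊆ G u w auw))))
         (≤-trans (term≤sum (λ x → [ V x ]) w) (≤-reflexive V≡0)))))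

min-degree-vertex : (a : Fin n → Fin n → Bool) (V : Fin n → Bool) → 1 ≤ ∣ V ∣ →
  ∃ λ v → V v ≡ true × (∀ x → V x ≡ true → ∣ a v ∣ ≤ ∣ a x ∣)
min-degree-vertex a V 1≤ with sum-positive (λ x → [ V x ]) 1≤
... | x , 1≤Vx = argmin V (λ x → ∣ a x ∣) x ([]-positive 1≤Vx)

⌊/2⌋-greatest : ∀ {p} n → 2 * p ≤ n → p ≤ ⌊ n /2⌋
⌊/2⌋-greatest {p} n 2p≤n = ≤-trans (≤-reflexive (n≡⌊n+n/2⌋ p))
  (⌊n/2⌋-mono (≤-trans (≤-reflexive (cong (p +_) (sym (+-identityʳ p)))) 2p≤n))

-- This is ⌊n²/4⌋ (`n*n/4≡quarter-square`), in a form whose increments are the halves that a removal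
-- may cost.
quarter-square : ℕ → ℕ
quarter-square n = ⌊ n /2⌋ * ⌈ n /2⌉

quarter-square-suc : ∀ n → quarter-square (suc n) ≡ ⌊ suc n /2⌋ + quarter-square n
quarter-square-suc n = trans (*-suc ⌊ suc n /2⌋ ⌊ n /2⌋)
  (cong (⌊ suc n /2⌋ +_) (*-comm ⌊ suc n /2⌋ ⌊ n /2⌋))

-- At a vertex of minimum degree the degrees on the two sides of `2count` cancel.
half-split : ∀ {a : Fin n → Fin n → Bool} {V} → IsGraphOn a V → 1 ≤ ∣ V ∣ →
  ∃₂ λ v p → V v ≡ true × NeighbourhoodPartition a v p × 2 * p ≤ ∣ V ∣
half-split {a = a} {V} G 1≤ with min-degree-vertex a V 1≤
... | v , Vv , min = v , _ , Vv , GreedySplit.partition S ,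
    +-cancelʳ-≤ ∣ a v ∣ _ _ (≤-trans 2count (≤-reflexive (+-comm ∣ a v ∣ ∣ V ∣)))
  where
  open Neighbourhood G
  S = greedySplit v
  open MinDegree (∣ a v ∣) min v Vv S

-- Induction on the number of vertices: removing a vertex of minimum degree costs at most half that
-- number of members, rounded down, and these halves add up to ⌊n²/4⌋.
erdős-goodman-pósa : ∀ n′ {a : Fin n → Fin n → Bool} {V} → IsGraphOn a V → ∣ V ∣ ≡ n′ →
  ∃ λ k → PartitionsInto a k × k ≤ quarter-square n′
erdős-goodman-pósa zero G size = 0 , empty-graph G size , z≤n
erdős-goodman-pósa (suc n′) {a} {V} G size
  with half-split G (≤-trans (s≤s z≤n) (≤-reflexive (sym size)))
... | v , p , Vv , N , 2p≤ with remove G N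
...   | red with erdős-goodman-pósa n′ (Reduction.graph red)
                  (suc-injective (trans (∣∖∣ V Vv) size))
...     | k , F , k≤ = p + k , Reduction.extend red F , (begin
    p + k
      ≤⟨ +-mono-≤ (⌊/2⌋-greatest (suc n′) (≤-trans 2p≤ (≤-reflexive size))) k≤ ⟩
    ⌊ suc n′ /2⌋ + quarter-square n′
      ≡⟨ quarter-square-suc n′ ⟨
    quarter-square (suc n′) ∎)
  where open ≤-Reasoning

-- Cheap vertices and dense pairs of independent sets

-- The factors 4 and 36 are those of `first-large` and `cross-large`. Together they give at least
-- |V|²/144 adjacent pairs in `I` × `J`.
record DensePair {n} (a : Fin n → Fin n → Bool) (V : Fin n → Bool) : Set where
  field
    I J           : Fin n → Bool
    I⊆V           : I ⊆ V
    J⊆V           : J ⊆ V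
    I-independent : Independent a I
    J-independent : Independent a J
    I-large       : ∣ V ∣ ≤ 4 * ∣ I ∣
    cross-degree  : ∀ x → I x ≡ true → ∣ V ∣ ≤ 36 * ∣ (λ w → a x w ∧ J w) ∣

<⌊/2⌋-bound : ∀ {n} c → suc ⌊ n /2⌋ ≤ c → n ≤ 2 * c
<⌊/2⌋-bound {n} c h = begin
  n                     ≡⟨ ⌊n/2⌋+⌈n/2⌉≡n n ⟨
  ⌊ n /2⌋ + ⌈ n /2⌉     ≤⟨ +-mono-≤ (<⇒≤ h) (≤-trans (⌈n/2⌉≤1+⌊n/2⌋ n) h) ⟩
  c + c                 ≡⟨ cong (c +_) (+-identityʳ c) ⟨
  2 * c                 ∎
  where
  open ≤-Reasoning
  ⌈n/2⌉≤1+⌊n/2⌋ : ∀ n → ⌈ n /2⌉ ≤ suc ⌊ n /2⌋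
  ⌈n/2⌉≤1+⌊n/2⌋ zero          = z≤n
  ⌈n/2⌉≤1+⌊n/2⌋ (suc zero)    = ≤-refl
  ⌈n/2⌉≤1+⌊n/2⌋ (suc (suc n)) = s≤s (⌈n/2⌉≤1+⌊n/2⌋ n)

-- N = |V|, d is the minimum degree, and i and j are the sizes of the independent
-- sets found in N(v) and N(u).  The variable c counts the parts of N(v) or N(u),
-- and in cross-large the neighbours that some x in the first set has in the second.
module StepArithmetic (N W d i : ℕ) (252W≤N : 252 * W ≤ N) where

  first-independent : ∀ c → N ≤ 2 * (c + W) → 6 * c + 2 * d ≤ 2 * d + 2 * N + 3 * i →
                      N ≤ 3 * i + 6 * W
  first-independent c N≤ 6c≤ = from-combination (+-mono-≤ (*-monoʳ-≤ 3 N≤) 6c≤) (e N c W d i)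
    where
    e : ∀ N c W d i → N + (3 * (2 * (c + W)) + (2 * d + 2 * N + 3 * i)) ≡
                      (3 * i + 6 * W) + (3 * N + (6 * c + 2 * d))
    e = solve-∀

  -- From i ≥ N/3 - 2W and W ≤ N/252 follows i ≥ 41N/126, which exceeds N/4.
  first-large : N ≤ 3 * i + 6 * W → N ≤ 4 * i
  first-large N≤ = *-cancelˡ-≤ 41 (from-combination
    (+-mono-≤ (*-monoʳ-≤ 42 N≤) (+-mono-≤ 252W≤N (z≤n {38 * i}))) (e N i W))
    where
    e : ∀ N i W → 41 * N + (42 * (3 * i + 6 * W) + (N + 38 * i)) ≡
                  41 * (4 * i) + (42 * N + (252 * W + 0))
    e = solve-∀

  -- The degree `D` of the second vertex may exceed `d`, but it is at most N - i, about 2N/3. This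
  -- weakens the bound N/3 of the first set to j ≥ 2N/9 - 4W.
  second-independent : ∀ c D j → N ≤ 2 * (c + W) → 6 * c + 2 * d ≤ 2 * D + 2 * N + 3 * j →
    i + D ≤ N → N ≤ 2 * (d + W) → N ≤ 3 * i + 6 * W → 2 * N ≤ 9 * j + 36 * W
  second-independent c D j N≤c 6c≤ i+D≤ N≤d N≤i = from-combination
    (+-mono-≤ (+-mono-≤ (*-monoʳ-≤ 9 N≤c) (*-monoʳ-≤ 3 6c≤))
    (+-mono-≤ (*-monoʳ-≤ 6 i+D≤) (+-mono-≤ (*-monoʳ-≤ 3 N≤d) (*-monoʳ-≤ 2 N≤i))))
    (e N c W d D i j)
    where
    e : ∀ N c W d D i j →
      2 * N + (9 * (2 * (c + W)) + 3 * (2 * D + 2 * N + 3 * j) +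
               (6 * N + (3 * (2 * (d + W)) + 2 * (3 * i + 6 * W)))) ≡
      9 * j + 36 * W + (9 * N + 3 * (6 * c + 2 * d) + (6 * (i + D) + (3 * N + 2 * N)))
    e = solve-∀

  -- The three sizes are at least N/2 - W, N/3 - 2W and 2N/9 - 4W, in sum 19N/18 - 7W. The excess
  -- over N is at least N/18 - 7W ≥ N/36, which is where 252 = 7 · 36 comes from.
  cross-large : ∀ j D c → d ≤ D → D + i + j ≤ N + c → N ≤ 2 * (d + W) → N ≤ 3 * i + 6 * W →
                2 * N ≤ 9 * j + 36 * W → N ≤ 36 * c
  cross-large j D c d≤D D+i+j≤ N≤d N≤i 2N≤j = from-combination
    (+-mono-≤ (*-monoʳ-≤ 36 (≤-trans (+-monoˡ-≤ j (+-monoˡ-≤ i d≤D)) D+i+j≤))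
    (+-mono-≤ (+-mono-≤ (*-monoʳ-≤ 18 N≤d) (*-monoʳ-≤ 12 N≤i))
              (+-mono-≤ (*-monoʳ-≤ 4 2N≤j) 252W≤N)))
    (e N d i j W c)
    where
    e : ∀ N d i j W c →
      N + (36 * (N + c) + ((18 * (2 * (d + W)) + 12 * (3 * i + 6 * W)) + (4 * (9 * j + 36 * W) + N))) ≡
      36 * c + (36 * (d + i + j) + ((18 * N + 12 * N) + (4 * (2 * N) + 252 * W)))
    e = solve-∀

-- If the neighbourhood of a vertex v of minimum degree splits into too many
-- parts, then it has a large independent set I; if the same happens for some
-- u ∈ I, then so does N(u), which is disjoint from I.
cheap-vertex-or-dense-pair :
  ∀ W {a : Fin n → Fin n → Bool} {V} → IsGraphOn a V → 1 ≤ ∣ V ∣ → 252 * W ≤ ∣ V ∣ →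
  (∃₂ λ v p → V v ≡ true × NeighbourhoodPartition a v p × p + W ≤ ⌊ ∣ V ∣ /2⌋) ⊎ DensePair a V
cheap-vertex-or-dense-pair {n} W {a} {V} G 1≤V 252W≤V
  with min-degree-vertex a V 1≤V
... | v , Vv , min = try-v (S.count + W ≤? ⌊ N /2⌋)
  where
  open Neighbourhood G
  open IsGraphOn G
  N = ∣ V ∣
  d = ∣ a v ∣
  module S  = GreedySplit (greedySplit v)
  module MS = MinDegree d min v Vv (greedySplit v)
  i = ∣ S.I ∣

  open StepArithmetic N W d i 252W≤V

  Goal = (∃₂ λ v p → V v ≡ true × NeighbourhoodPartition a v p × p + W ≤ ⌊ N /2⌋) ⊎ DensePair a V

  module Expensive (v-bad : S.count + W ≰ ⌊ N /2⌋) where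
    N≤2d+2W : N ≤ 2 * (d + W)
    N≤2d+2W = ≤-trans (<⌊/2⌋-bound (S.count + W) (≰⇒> v-bad))
                      (*-monoʳ-≤ 2 (+-monoˡ-≤ W MS.count≤degree))

    N≤3i+6W : N ≤ 3 * i + 6 * W
    N≤3i+6W = first-independent S.count (<⌊/2⌋-bound (S.count + W) (≰⇒> v-bad)) MS.6count

    I-large : N ≤ 4 * i
    I-large = first-large N≤3i+6W

    I-nonempty : 1 ≤ i
    I-nonempty = n≢0⇒n>0 λ i≡0 → <⇒≱ 1≤V (subst (λ i → N ≤ 4 * i) i≡0 I-large)

  module Dense (v-bad : S.count + W ≰ ⌊ N /2⌋) (u : Fin n) (Iu : S.I u ≡ true) where
    open Expensive v-bad
    Vu : V u ≡ true
    Vu = S.I⊆V u Iu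
    module T  = GreedySplit (greedySplit u)
    module MT = MinDegree d min u Vu (greedySplit u)
    j = ∣ T.I ∣

    module Inequalities (u-bad : T.count + W ≰ ⌊ N /2⌋) where
      2N≤9j+36W : 2 * N ≤ 9 * j + 36 * W
      2N≤9j+36W = second-independent T.count (∣ a u ∣) j
        (<⌊/2⌋-bound (T.count + W) (≰⇒> u-bad)) MT.6count
        (independent-degree S.I⊆V S.I-independent Iu) N≤2d+2W N≤3i+6W

      J∩I : ∀ w → S.I w ≡ true → T.I w ≡ false
      J∩I w Iw = ≡false λ Jw → true≢false (T.R⊆N w (T.I⊆R w Jw)) (S.I-independent u w Iu Iw)

      cross : (x : Fin n) → Fin n → Bool
      cross x w = a x w ∧ T.I w

      -- The first set is disjoint from N(x) and from the second set, so only the vertices of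
      -- `cross x` are counted twice on the left.
      cross-sum : ∀ {x} → S.I x ≡ true → ∣ a x ∣ + i + j ≤ N + ∣ cross x ∣
      cross-sum {x} Ix = begin
        ∣ a x ∣ + i + j
          ≡⟨ cong (_+ j) (∑-distrib-+ (λ w → [ a x w ]) (λ w → [ S.I w ])) ⟨
        (sum λ w → [ a x w ] + [ S.I w ]) + j
          ≡⟨ ∑-distrib-+ (λ w → [ a x w ] + [ S.I w ]) (λ w → [ T.I w ]) ⟨
        (sum λ w → [ a x w ] + [ S.I w ] + [ T.I w ])
          ≤⟨ sum-mono pointwise ⟩
        (sum λ w → [ V w ] + [ cross x w ])
          ≡⟨ ∑-distrib-+ (λ w → [ V w ]) (λ w → [ cross x w ]) ⟩
        N + ∣ cross x ∣ ∎
        where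
        open ≤-Reasoning
        pointwise : ∀ w → [ a x w ] + [ S.I w ] + [ T.I w ] ≤ [ V w ] + [ cross x w ]
        pointwise w with S.I w in Iw | T.I w in Jw
        ... | true  | true  = ⊥-elim (true≢false Jw (J∩I w Iw))
        ... | true  | false rewrite S.I-independent x w Ix Iw | S.I⊆V w Iw = s≤s z≤n
        ... | false | true  rewrite T.I⊆V w Jw | Bool.∧-identityʳ (a x w) =
          ≤-reflexive (trans (cong (_+ 1) (+-identityʳ [ a x w ])) (+-comm [ a x w ] 1))
        ... | false | false rewrite +-identityʳ [ a x w ] | +-identityʳ [ a x w ] =
          ≤-trans ([]-mono (adj-⊆ x w)) (m≤m+n _ _)

      cross-degree : ∀ x → S.I x ≡ true → N ≤ 36 * ∣ cross x ∣
      cross-degree x Ix = cross-large j (∣ a x ∣) (∣ cross x ∣)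
        (min x (S.I⊆V x Ix)) (cross-sum Ix) N≤2d+2W N≤3i+6W 2N≤9j+36W

      densePair : DensePair a V
      densePair = record
        { I = S.I ; J = T.I ; I⊆V = S.I⊆V ; J⊆V = T.I⊆V
        ; I-independent = S.I-independent ; J-independent = T.I-independent
        ; I-large = I-large ; cross-degree = cross-degree }

    try-u : Dec (T.count + W ≤ ⌊ N /2⌋) → Goal
    try-u (yes cheap) = inj₁ (u , T.count , Vu , T.partition , cheap)
    try-u (no u-bad)  = inj₂ (Inequalities.densePair u-bad)

  try-v : Dec (S.count + W ≤ ⌊ N /2⌋) → Goal
  try-v (yes cheap) = inj₁ (v , S.count , Vv , S.partition , cheap)
  try-v (no v-bad) =
    let u , 1≤Iu = sum-positive (λ x → [ S.I x ]) (Expensive.I-nonempty v-bad)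
    in Dense.try-u v-bad u ([]-positive 1≤Iu) (_ ≤? _)

-- Coverings of a dense pair, and peeling off vertices

sum*sum : (f : Vector ℕ m) (h : Vector ℕ n) →
          (sum λ x → sum λ w → f x * h w) ≡ sum f * sum h
sum*sum f h = trans (sum-cong-≗ λ x → sym (*-distribˡ-sum (f x) h)) (sym (*-distribʳ-sum (sum h) f))

sum³-rotate : (f : Fin m → Fin n → Fin p → ℕ) →
  (sum λ x → sum λ y → sum λ z → f x y z) ≡ (sum λ z → sum λ x → sum λ y → f x y z)
sum³-rotate f = trans (sum-cong-≗ λ x → ∑-comm (f x)) (∑-comm λ x z → sum λ y → f x y z)

-- Since 252 = 12 · 21, the factor 144 cancels.
few-cliques : ∀ W K {N l l′} → 252 * W ≤ N → N * N ≤ 144 * (K * (l * l)) → l ≤ l′ →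
              (21 * W) * (21 * W) ≤ K * (l′ * l′)
few-cliques W K {N} {l} {l′} 252W≤N N²≤ l≤l′ = *-cancelˡ-≤ 144 (begin
  144 * ((21 * W) * (21 * W))   ≡⟨ e W ⟩
  (252 * W) * (252 * W)         ≤⟨ *-mono-≤ 252W≤N 252W≤N ⟩
  N * N                         ≤⟨ N²≤ ⟩
  144 * (K * (l * l))           ≤⟨ *-monoʳ-≤ 144 (*-monoʳ-≤ K (*-mono-≤ l≤l′ l≤l′)) ⟩
  144 * (K * (l′ * l′))         ∎)
  where
  open ≤-Reasoning
  e : ∀ W → 144 * ((21 * W) * (21 * W)) ≡ (252 * W) * (252 * W)
  e = solve-∀

module CliqueCover {n K} (g : Fin n → Fin n → Bool) (F : Fin K → Fin n → Bool)
                   (cliques : ∀ i → Clique g (F i))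
                   (covers : ∀ x y → g x y ≡ true → ∃ λ i → F i x ≡ true × F i y ≡ true) where

  -- Every adjacent pair in `I` × `J` lies in some member, and the product on the right is the
  -- number of pairs available in member `i`.
  covered-edges : {a : Fin n → Fin n → Bool} → (∀ x y → a x y ≡ true → g x y ≡ true) →
    (I J : Fin n → Bool) →
    (sum λ x → [ I x ] * ∣ (λ w → a x w ∧ J w) ∣) ≤
    (sum λ i → ∣ (λ x → F i x ∧ I x) ∣ * ∣ (λ w → F i w ∧ J w) ∣)
  covered-edges {a} a⊆g I J = begin
    (sum λ x → [ I x ] * ∣ (λ w → a x w ∧ J w) ∣)
      ≡⟨ sum-cong-≗ (λ x → *-distribˡ-sum [ I x ] (λ w → [ a x w ∧ J w ])) ⟩
    (sum λ x → sum λ w → [ I x ] * [ a x w ∧ J w ])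
      ≤⟨ sum-mono (λ x → sum-mono (in-member x)) ⟩
    (sum λ x → sum λ w → sum λ i → [ FI i x ] * [ FJ i w ])
      ≡⟨ sum³-rotate (λ x w i → [ FI i x ] * [ FJ i w ]) ⟩
    (sum λ i → sum λ x → sum λ w → [ FI i x ] * [ FJ i w ])
      ≡⟨ sum-cong-≗ (λ i → sum*sum (λ x → [ FI i x ]) (λ w → [ FJ i w ])) ⟩
    (sum λ i → ∣ FI i ∣ * ∣ FJ i ∣) ∎
    where
    open ≤-Reasoning
    FI FJ : Fin K → Fin n → Bool
    FI i x = F i x ∧ I x
    FJ i w = F i w ∧ J w

    in-member : ∀ x w → [ I x ] * [ a x w ∧ J w ] ≤ sum λ i → [ FI i x ] * [ FJ i w ]
    in-member x w with I x in Ix | a x w in axw | J w in Jw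
    ... | false | _     | _     = z≤n
    ... | true  | false | _     = z≤n
    ... | true  | true  | false = z≤n
    ... | true  | true  | true with covers x w (a⊆g x w axw)
    ...   | i , Fx , Fw = ≤-trans
      (≤-reflexive (sym (cong₂ (λ b c → [ b ∧ true ] * [ c ∧ true ]) Fx Fw)))
      (term≤sum (λ i → [ F i x ∧ true ] * [ F i w ∧ true ]) i)

  module _ {a : Fin n → Fin n → Bool} {V} (L : ℕ)
           (lost≤ : ∀ x → V x ≡ true → ∣ lost g a V x ∣ ≤ L) where

    -- Fix a vertex `x` of the intersection. Its edges in `g` to the other vertices there are all
    -- missing from `a`, and `x` has lost at most `L`; the `suc` accounts for `x` itself.
    clique∩independent : ∀ {I} → I ⊆ V → Independent a I → ∀ i →
                         ∣ (λ w → F i w ∧ I w) ∣ ≤ suc L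
    clique∩independent {I} I⊆V ind i with ∣ (λ w → F i w ∧ I w) ∣ in eq
    ... | zero  = z≤n
    ... | suc _ with sum-positive (λ w → [ F i w ∧ I w ]) (≤-trans (s≤s z≤n) (≤-reflexive (sym eq)))
    ...   | x , 1≤ = subst (_≤ suc L) eq (begin
      ∣ (λ w → F i w ∧ I w) ∣               ≤⟨ sum-mono pointwise ⟩
      (sum λ w → [ δ x w ] + [ lost g a V x w ])
        ≡⟨ ∑-distrib-+ (λ w → [ δ x w ]) (λ w → [ lost g a V x w ]) ⟩
      ∣ δ x ∣ + ∣ lost g a V x ∣            ≤⟨ +-mono-≤ (≤-reflexive (∣δ∣ x)) (lost≤ x (I⊆V x (proj₂ both))) ⟩
      suc L                                 ∎)
      where
      open ≤-Reasoning
      both : F i x ≡ true × I x ≡ true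
      both = ∧-true ([]-positive 1≤)
      pointwise : ∀ w → [ F i w ∧ I w ] ≤ [ δ x w ] + [ lost g a V x w ]
      pointwise w with F i w in Fw | I w in Iw
      ... | false | _     = z≤n
      ... | true  | false = z≤n
      ... | true  | true  with x Fin.≟ w
      ...   | yes _  = s≤s z≤n
      ...   | no x≢w rewrite cliques i x w x≢w (proj₁ both) Fw | I⊆V w Iw
                           | ind x w (proj₂ both) Iw = ≤-refl

    -- There are at least |V|²/144 adjacent pairs between the two sets, and each of the `K` cliques
    -- covers at most (L+1)² of them.
    dense-pair-bound : (∀ x y → a x y ≡ true → g x y ≡ true) → DensePair a V →
                       ∣ V ∣ * ∣ V ∣ ≤ 144 * (K * (suc L * suc L))
    dense-pair-bound a⊆g D = begin
      ∣ V ∣ * ∣ V ∣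
        ≤⟨ *-monoˡ-≤ ∣ V ∣ I-large ⟩
      4 * ∣ I ∣ * ∣ V ∣
        ≡⟨ trans (*-assoc 4 ∣ I ∣ ∣ V ∣) (cong (4 *_) (*-distribʳ-sum ∣ V ∣ (λ x → [ I x ]))) ⟩
      4 * (sum λ x → [ I x ] * ∣ V ∣)
        ≤⟨ *-monoʳ-≤ 4 (sum-mono at-x) ⟩
      4 * (sum λ x → 36 * ([ I x ] * ∣ cross x ∣))
        ≡⟨ cong (4 *_) (*-distribˡ-sum 36 (λ x → [ I x ] * ∣ cross x ∣)) ⟨
      4 * (36 * (sum λ x → [ I x ] * ∣ cross x ∣))
        ≡⟨ *-assoc 4 36 (sum λ x → [ I x ] * ∣ cross x ∣) ⟨
      144 * (sum λ x → [ I x ] * ∣ cross x ∣)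
        ≤⟨ *-monoʳ-≤ 144 (≤-trans (covered-edges a⊆g I J) (≤-trans
             (sum-mono λ i → *-mono-≤ (clique∩independent I⊆V I-independent i)
                                      (clique∩independent J⊆V J-independent i))
             (≤-reflexive (sum-const K (suc L * suc L))))) ⟩
      144 * (K * (suc L * suc L)) ∎
      where
      open ≤-Reasoning
      open DensePair D
      cross : Fin n → Fin n → Bool
      cross x w = a x w ∧ J w

      at-x : ∀ x → [ I x ] * ∣ V ∣ ≤ 36 * ([ I x ] * ∣ cross x ∣)
      at-x x with I x in Ix
      ... | false = z≤n
      ... | true  = ≤-trans (≤-reflexive (*-identityˡ ∣ V ∣)) (≤-trans (cross-degree x Ix)
                      (≤-reflexive (cong (36 *_) (sym (*-identityˡ ∣ cross x ∣)))))

  -- A lower bound of order (W/s)² on the size `K` of the covering: after at most `s` removals a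
  -- clique of `g` meets a surviving independent set in at most 3s + 1 vertices.
  FewCliques : ℕ → ℕ → Set
  FewCliques W s = (21 * W) * (21 * W) ≤ K * (suc (s * 3) * suc (s * 3))

  CheapPartition : (a : Fin n → Fin n → Bool) → ℕ → ℕ → Set
  CheapPartition a N saved = ∃ λ k → PartitionsInto a k × k + saved ≤ quarter-square N

  peel-one : ∀ {a V} W r v p → V v ≡ true → p + W ≤ ⌊ ∣ V ∣ /2⌋ → (red : Reduction a V v p) →
             CheapPartition (Reduction.b red) ∣ V ∖ v ∣ (r * W) →
             CheapPartition a ∣ V ∣ (suc r * W)
  peel-one {a} {V} W r v p Vv cheap red (k , F′ , k≤) = p + k , Reduction.extend red F′ , (begin
    p + k + suc r * W                       ≡⟨ e p k W (r * W) ⟩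
    (p + W) + (k + r * W)                   ≤⟨ +-mono-≤ cheap k≤ ⟩
    ⌊ ∣ V ∣ /2⌋ + quarter-square ∣ V ∖ v ∣  ≡⟨ cong (λ m → ⌊ m /2⌋ + quarter-square ∣ V ∖ v ∣) (∣∖∣ V Vv) ⟨
    ⌊ suc ∣ V ∖ v ∣ /2⌋ + quarter-square ∣ V ∖ v ∣ ≡⟨ quarter-square-suc ∣ V ∖ v ∣ ⟨
    quarter-square (suc ∣ V ∖ v ∣)          ≡⟨ cong quarter-square (∣∖∣ V Vv) ⟩
    quarter-square ∣ V ∣                    ∎)
    where
    open ≤-Reasoning
    e : ∀ p k W rW → p + k + (W + rW) ≡ (p + W) + (k + rW)
    e = solve-∀

  -- Here `j` removals are done and `r` remain. Each removal of a cheap vertex saves `W` against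
  -- ⌊N²/4⌋ and costs a surviving vertex at most 3 lost edges; the first dense pair ends the process
  -- with the bound on `K`. The summand `r` in the size hypothesis keeps at least 252W vertices
  -- throughout.
  peel : ∀ W s r j → r + j ≡ s → ∀ {a V} → IsGraphOn a V →
         (∀ x y → a x y ≡ true → g x y ≡ true) →
         (∀ x → V x ≡ true → ∣ lost g a V x ∣ ≤ j * 3) →
         252 * W + r ≤ ∣ V ∣ →
         CheapPartition a ∣ V ∣ (r * W) ⊎ FewCliques W s
  peel W s zero j r+j≡s {a} {V} G a⊆g lost≤ large =
    let k , F′ , k≤ = erdős-goodman-pósa ∣ V ∣ G refl
    in inj₁ (k , F′ , ≤-trans (≤-reflexive (+-identityʳ k)) k≤)
  peel W s (suc r) j r+j≡s {a} {V} G a⊆g lost≤ large = [ cheap-vertex , dense-pair ]′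
    (cheap-vertex-or-dense-pair W G
      (≤-trans (s≤s z≤n) (≤-trans (m≤n+m (suc r) (252 * W)) large))
      (≤-trans (m≤m+n (252 * W) (suc r)) large))
    where
    cheap-vertex : (∃₂ λ v p → V v ≡ true × NeighbourhoodPartition a v p × p + W ≤ ⌊ ∣ V ∣ /2⌋) →
                   CheapPartition a ∣ V ∣ (suc r * W) ⊎ FewCliques W s
    cheap-vertex (v , p , Vv , N , cheap) = map₁ (peel-one W r v p Vv cheap red)
      (peel W s r (suc j) (trans (+-suc r j) r+j≡s) (Reduction.graph red)
        (λ x y bxy → a⊆g x y (Reduction.b⊆a red bxy))
        (λ x V′x → ≤-trans (Reduction.lost-step red g V′x)
          (≤-trans (+-monoˡ-≤ 3 (lost≤ x (proj₁ (∧-true V′x)))) (≤-reflexive (+-comm (j * 3) 3))))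
        (≤-pred (≤-trans (≤-reflexive (sym (+-suc (252 * W) r)))
                         (≤-trans large (≤-reflexive (sym (∣∖∣ V Vv)))))))
      where
      red = remove G N

    dense-pair : DensePair a V → CheapPartition a ∣ V ∣ (suc r * W) ⊎ FewCliques W s
    dense-pair D = inj₂ (few-cliques W K (≤-trans (m≤m+n (252 * W) (suc r)) large)
      (dense-pair-bound (j * 3) lost≤ a⊆g D)
      (s≤s (*-monoˡ-≤ 3 (≤-trans (m≤n+m j (suc r)) (≤-reflexive r+j≡s)))))

-- From Boolean adjacency to `cp` and `cc` of a graph

∈⇒true : ∀ {x} {S : Subset n} → x ∈ S → lookup S x ≡ true
∈⇒true = []=⇒lookup

true⇒∈ : ∀ {x} {S : Subset n} → lookup S x ≡ true → x ∈ S
true⇒∈ {x = x} {S} = lookup⇒[]= x S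

at-most-one : (Q : Fin n → Bool) → (∀ x y → Q x ≡ true → Q y ≡ true → x ≡ y) → ∣ Q ∣ ≤ 1
at-most-one Q unique with ∣ Q ∣ in eq
... | zero  = z≤n
... | suc _ with sum-positive (λ x → [ Q x ]) (≤-trans (s≤s z≤n) (≤-reflexive (sym eq)))
...   | x , 1≤Qx = subst (_≤ 1) eq (≤-trans
  (∣∣-mono λ y Qy → subst (λ z → δ x z ≡ true) (unique x y ([]-positive 1≤Qx) Qy) (δ-refl x))
  (≤-reflexive (∣δ∣ x)))

unique-member : (Q : Fin n → Bool) → ∣ Q ∣ ≤ 1 → ∀ {x y} → Q x ≡ true → Q y ≡ true → x ≡ y
unique-member Q Q≤1 {x} {y} Qx Qy = decidable-stable (x Fin.≟ y) λ x≢y → 1+n≰n (begin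
  2                                 ≡⟨ cong₂ _+_ (∣δ∣ x) (∣δ∣ y) ⟨
  ∣ δ x ∣ + ∣ δ y ∣                 ≡⟨ ∑-distrib-+ (λ w → [ δ x w ]) (λ w → [ δ y w ]) ⟨
  (sum λ w → [ δ x w ] + [ δ y w ]) ≤⟨ sum-mono (λ w → []-disjoint {d = Q w}
    (λ eq → subst (λ z → Q z ≡ true) (δ-≡ {w = w} eq) Qx)
    (λ eq → subst (λ z → Q z ≡ true) (δ-≡ {w = w} eq) Qy)
    (λ eq → δ-≢ {w = w} λ y≡w → x≢y (trans (δ-≡ eq) (sym y≡w)))) ⟩
  ∣ Q ∣                             ≤⟨ Q≤1 ⟩
  1                                 ∎)
  where open ≤-Reasoning

module _ (G : Graph n) where

  adj : Fin n → Fin n → Bool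
  adj u v = does (adj? G u v)

  adj-sound : ∀ {u v} → adj u v ≡ true → Adj G u v
  adj-sound {u} {v} eq with adj? G u v
  ... | yes e = e

  adj-complete : ∀ {u v} → Adj G u v → adj u v ≡ true
  adj-complete {u} {v} = dec-true (adj? G u v)

  adj-graph : IsGraphOn adj (const true)
  adj-graph = record
    { adj-sym    = λ x y → adj-sym x y
    ; adj-irrefl = λ x → dec-false (adj? G x x) (irrefl G refl)
    ; adj-⊆      = λ _ _ _ → refl }
    where
    adj-sym : ∀ x y → adj x y ≡ adj y x
    adj-sym x y with adj? G x y
    ... | yes e = sym (adj-complete (symm G e))
    ... | no ¬e = sym (dec-false (adj? G y x) (¬e ∘ symm G))

  fromPartition : PartitionsInto adj k → HasCliquePartition G k
  fromPartition {k} (F , eqs) = tabulate (tabulate ∘ F) , (clique , cover) , once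
    where
    member : ∀ i x → lookup (lookup (tabulate (tabulate ∘ F)) i) x ≡ F i x
    member i x = trans (cong (λ S → lookup S x) (lookup∘tabulate (tabulate ∘ F) i))
                       (lookup∘tabulate (F i) x)
    both : Fin n → Fin n → Fin k → Bool
    both u v i = F i u ∧ F i v
    to : ∀ {i x} → F i x ≡ true → x ∈ lookup (tabulate (tabulate ∘ F)) i
    to {i} {x} Fx = true⇒∈ (trans (member i x) Fx)
    from : ∀ {i x} → x ∈ lookup (tabulate (tabulate ∘ F)) i → F i x ≡ true
    from {i} {x} x∈ = trans (sym (member i x)) (∈⇒true x∈)
    clique : ∀ i → IsClique G (lookup (tabulate (tabulate ∘ F)) i)
    clique i u v u∈ v∈ u≢v = adj-sound ([]-positive (≤-trans
      (≤-reflexive (sym (cong₂ (λ b c → [ b ∧ c ]) (from {i} u∈) (from {i} v∈))))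
      (≤-trans (term≤sum (λ i → [ both u v i ]) i) (≤-reflexive (eqs u v u≢v)))))
    size : ∀ {u v} → Adj G u v → ∣ both u v ∣ ≡ 1
    size {u} {v} e = trans (eqs u v (λ u≡v → irrefl G u≡v e)) ([]-true (adj-complete e))
    cover : ∀ u v → Adj G u v → ∃ λ i → u ∈ lookup (tabulate (tabulate ∘ F)) i ×
                                        v ∈ lookup (tabulate (tabulate ∘ F)) i
    cover u v e =
      let i , 1≤ = sum-positive (λ i → [ both u v i ]) (≤-reflexive (sym (size e)))
          Fu , Fv = ∧-true ([]-positive 1≤)
      in i , to Fu , to Fv
    once : ∀ u v → Adj G u v → ∃! _≡_ λ i → u ∈ lookup (tabulate (tabulate ∘ F)) i ×
                                            v ∈ lookup (tabulate (tabulate ∘ F)) i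
    once u v e =
      let i , u∈ , v∈ = cover u v e
      in i , (u∈ , v∈) , λ {j} (u∈′ , v∈′) → unique-member (both u v) (≤-reflexive (size e))
           (∧-intro (from {i} u∈) (from {i} v∈)) (∧-intro (from {j} u∈′) (from {j} v∈′))
      where
      ∧-intro : ∀ {b c} → b ≡ true → c ≡ true → b ∧ c ≡ true
      ∧-intro refl refl = refl

  cp≤ : PartitionsInto adj k → cp G ≤ k
  cp≤ {k} F = proj₂ (proj₂ (cp-exists G)) k (fromPartition F)

  cp≤quarter-square : cp G ≤ quarter-square n
  cp≤quarter-square =
    let k , F , k≤ = erdős-goodman-pósa n adj-graph (trans (sum-const n 1) (*-identityʳ n))
    in ≤-trans (cp≤ F) k≤

  -- Peeling starts at the graph itself, where nothing is lost yet, and the family of cliques is a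
  -- minimum covering.
  cp-or-cc-bound : ∀ W r → 252 * W + r ≤ n →
    cp G + r * W ≤ quarter-square n ⊎
    (21 * W) * (21 * W) ≤ cc G * (suc (r * 3) * suc (r * 3))
  cp-or-cc-bound W r large = map₁
    (λ { (k , F , k≤) → ≤-trans (+-monoˡ-≤ (r * W) (cp≤ F))
                          (subst (λ m → k + r * W ≤ quarter-square m) size k≤) })
    (peel W r r 0 (+-identityʳ r) adj-graph (λ _ _ e → e)
      (λ x _ → ≤-reflexive (sum-zero λ w → nothing-lost (adj x w)))
      (≤-trans large (≤-reflexive (sym size))))
    where
    size : ∣ const {B = Fin n} true ∣ ≡ n
    size = trans (sum-const n 1) (*-identityʳ n)
    nothing-lost : ∀ b → [ b ∧ (true ∧ not b) ] ≡ 0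
    nothing-lost true  = refl
    nothing-lost false = refl
    𝓕 = proj₁ (proj₁ (proj₂ (cc-exists G)))
    covering = proj₂ (proj₁ (proj₂ (cc-exists G)))
    member : Fin (cc G) → Fin n → Bool
    member i = lookup (lookup 𝓕 i)
    member-clique : ∀ i → Clique adj (member i)
    member-clique i x y x≢y Fx Fy =
      adj-complete (proj₁ covering i x y (true⇒∈ Fx) (true⇒∈ Fy) x≢y)
    member-cover : ∀ x y → adj x y ≡ true → ∃ λ i → member i x ≡ true × member i y ≡ true
    member-cover x y e = let i , x∈ , y∈ = proj₂ covering x y (adj-sound e)
                         in i , ∈⇒true x∈ , ∈⇒true y∈
    open CliqueCover adj member member-clique member-cover

-- Parity, blocks of consecutive numbers, and an inequality for members

even odd : ℕ → Bool
even zero    = true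
even (suc x) = odd x
odd zero     = false
odd (suc x)  = even x

even-not-odd : ∀ x → even x ≡ true → odd x ≡ false
odd-not-even : ∀ x → odd x ≡ true → even x ≡ false
even-not-odd zero    _ = refl
even-not-odd (suc x)   = odd-not-even x
odd-not-even (suc x)   = even-not-odd x

even-or-odd : ∀ x → even x ≡ true ⊎ odd x ≡ true
even-or-odd zero    = inj₁ refl
even-or-odd (suc x) = [ inj₂ , inj₁ ]′ (even-or-odd x)

∣even∣ : ∀ n → ∣ (λ (x : Fin n) → even (toℕ x)) ∣ ≡ ⌈ n /2⌉
∣odd∣  : ∀ n → ∣ (λ (x : Fin n) → odd (toℕ x)) ∣ ≡ ⌊ n /2⌋
∣even∣ zero    = refl
∣even∣ (suc n) = cong suc (∣odd∣ n)
∣odd∣ zero     = refl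
∣odd∣ (suc n)  = ∣even∣ n

≡ᵇ-sound : ∀ {x y} → (x ≡ᵇ y) ≡ true → x ≡ y
≡ᵇ-sound {x} {y} eq = ≡ᵇ⇒≡ x y (subst Bool.T (sym eq) _)

≡ᵇ-complete : ∀ x → (x ≡ᵇ x) ≡ true
≡ᵇ-complete zero    = refl
≡ᵇ-complete (suc x) = ≡ᵇ-complete x

-- Within a block, each remainder modulo `S` occurs at most once.
block-size : ∀ S .{{_ : NonZero S}} q → ∣ (λ (y : Fin n) → toℕ y / S ≡ᵇ q) ∣ ≤ S
block-size {n} S q = begin
  ∣ (λ (y : Fin n) → toℕ y / S ≡ᵇ q) ∣   ≤⟨ sum-mono by-remainder ⟩
  (sum λ y → sum λ r → [ at r y ])       ≡⟨ ∑-comm (λ y r → [ at r y ]) ⟩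
  (sum λ r → ∣ at r ∣)                   ≤⟨ sum-mono (λ r → at-most-one (at r) λ x y ex ey →
                                              Fin.toℕ-injective (trans (≡ᵇ-sound ex) (sym (≡ᵇ-sound ey)))) ⟩
  sum {S} (const 1)                      ≡⟨ trans (sum-const S 1) (*-identityʳ S) ⟩
  S                                      ∎
  where
  open ≤-Reasoning
  at : Fin S → Fin n → Bool
  at r y = toℕ y ≡ᵇ toℕ r + q * S
  by-remainder : ∀ y → [ toℕ y / S ≡ᵇ q ] ≤ sum λ r → [ at r y ]
  by-remainder y with toℕ y / S ≡ᵇ q in eq
  ... | false = z≤n
  ... | true  = ≤-trans (≤-reflexive (sym ([]-true at-y))) (term≤sum (λ r → [ at r y ]) r)
    where
    r = fromℕ< (m%n<n (toℕ y) S)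
    at-y : at r y ≡ true
    at-y = subst (λ z → (toℕ y ≡ᵇ z) ≡ true)
      (trans (m≡m%n+[m/n]*n (toℕ y) S)
             (cong₂ (λ r q → r + q * S) (sym (Fin.toℕ-fromℕ< (m%n<n (toℕ y) S))) (≡ᵇ-sound {toℕ y / S} {q} eq)))
      (≡ᵇ-complete (toℕ y))

-- That is, e·o ≤ 1 + e(e-1) + o(o-1), with equality at e = o = 1, a single cross edge. For positive
-- numbers, subtracting one from each turns it into x·y ≤ x² + y².
e*o-bound : ∀ e o → e * o + (e + o) ≤ 1 + (e * e + o * o)
e*o-bound zero    o       = m≤n⇒m≤1+n (m≤m*m o)
  where
  m≤m*m : ∀ m → m ≤ m * m
  m≤m*m zero    = z≤n
  m≤m*m (suc m) = m≤m*n (suc m) (suc m)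
e*o-bound (suc e) zero    = m≤n⇒m≤1+n (begin
  suc e * 0 + (suc e + 0)   ≡⟨ cong₂ _+_ (*-zeroʳ e) (+-identityʳ (suc e)) ⟩
  suc e                     ≤⟨ m≤m*n (suc e) (suc e) ⟩
  suc e * suc e             ≤⟨ m≤m+n _ 0 ⟩
  suc e * suc e + 0         ∎)
  where open ≤-Reasoning
e*o-bound (suc e) (suc o) = from-combination (product≤squares e o) (eq e o)
  where
  product≤squares : ∀ x y → x * y ≤ x * x + y * y
  product≤squares x y with ≤-total x y
  ... | inj₁ x≤y = ≤-trans (*-monoˡ-≤ y x≤y) (m≤n+m _ _)
  ... | inj₂ y≤x = ≤-trans (*-monoʳ-≤ x y≤x) (m≤m+n _ _)
  eq : ∀ e o → suc e * suc o + (suc e + suc o) + (e * e + o * o) ≡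
               1 + (suc e * suc e + suc o * suc o) + e * o
  eq = solve-∀

-- The block graph

module BlockGraph (n S : ℕ) .{{_ : NonZero S}} where

  block : Fin n → ℕ
  block x = toℕ x / S

  Even Odd : Fin n → Bool
  Even x = even (toℕ x)
  Odd x  = odd (toℕ x)

  blockGraph : Graph n
  blockGraph = record
    { Adj    = λ x y → x ≢ y × (Even x ≢ Even y ⊎ block x ≡ block y)
    ; adj?   = λ x y → ¬? (x Fin.≟ y) ×-dec (¬? (Even x Bool.≟ Even y) ⊎-dec (block x ≟ block y))
    ; symm   = λ { (x≢y , e) → x≢y ∘ sym , Data.Sum.map (_∘ sym) sym e }
    ; irrefl = λ { x≡y (x≢y , _) → x≢y x≡y } }

  module _ {K} (F : Vec (Subset n) K) (partition : IsCliquePartition blockGraph F) where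

    Q : Fin K → Fin n → Bool
    Q i = lookup (lookup F i)

    Q-clique : ∀ i → Clique (adj blockGraph) (Q i)
    Q-clique i x y x≢y Qx Qy = adj-complete blockGraph
      (proj₁ (proj₁ partition) i x y (true⇒∈ Qx) (true⇒∈ Qy) x≢y)

    Q-covers : ∀ x y → adj blockGraph x y ≡ true → ∃ λ i → Q i x ≡ true × Q i y ≡ true
    Q-covers x y e = let i , x∈ , y∈ = proj₂ (proj₁ partition) x y (adj-sound blockGraph {x} {y} e)
                     in i , ∈⇒true x∈ , ∈⇒true y∈

    open CliqueCover (adj blockGraph) Q Q-clique Q-covers

    -- Two vertices on the same side lie in a common member at most once, and
    -- only if they share a block.
    side-pairs : (H : Fin n → Bool) → (∀ x y → H x ≡ true → H y ≡ true → Even x ≡ Even y) →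
      (sum λ i → ∣ (λ x → Q i x ∧ H x) ∣ * ∣ (λ x → Q i x ∧ H x) ∣) ≤
      (sum λ i → ∣ (λ x → Q i x ∧ H x) ∣) + ∣ H ∣ * S
    side-pairs H same-side = begin
      (sum λ i → ∣ QH i ∣ * ∣ QH i ∣)
        ≡⟨ sum-cong-≗ (λ i → sum*sum (λ x → [ QH i x ]) (λ y → [ QH i y ])) ⟨
      (sum λ i → sum λ x → sum λ y → [ QH i x ] * [ QH i y ])
        ≡⟨ sum³-rotate (λ x y i → [ QH i x ] * [ QH i y ]) ⟨
      (sum λ x → sum λ y → sum λ i → [ QH i x ] * [ QH i y ])
        ≤⟨ sum-mono at-x ⟩
      (sum λ x → (sum λ i → [ QH i x ]) + [ H x ] * S)
        ≡⟨ ∑-distrib-+ (λ x → sum λ i → [ QH i x ]) (λ x → [ H x ] * S) ⟩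
      (sum λ x → sum λ i → [ QH i x ]) + (sum λ x → [ H x ] * S)
        ≡⟨ cong₂ _+_ (∑-comm (λ x i → [ QH i x ])) (sym (*-distribʳ-sum S (λ x → [ H x ]))) ⟩
      (sum λ i → ∣ QH i ∣) + ∣ H ∣ * S ∎
      where
      open ≤-Reasoning
      QH : Fin K → Fin n → Bool
      QH i x = Q i x ∧ H x

      members : Fin n → ℕ
      members x = sum λ i → [ QH i x ]

      common≤ : ∀ x y → x ≢ y →
                (sum λ i → [ QH i x ] * [ QH i y ]) ≤ [ H x ] * [ block y ≡ᵇ block x ]
      common≤ x y x≢y with H x in Hx | H y in Hy
      ... | false | _     = ≤-reflexive (sum-zero {K} λ i →
        cong (λ b → [ b ] * [ Q i y ∧ _ ]) (Bool.∧-zeroʳ (Q i x)))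
      ... | true  | false = ≤-trans (≤-reflexive (sum-zero {K} λ i →
        trans (cong (λ b → [ Q i x ∧ true ] * [ b ]) (Bool.∧-zeroʳ (Q i y))) (*-zeroʳ [ Q i x ∧ true ]))) z≤n
      ... | true  | true  = ≤-trans (≤-reflexive (sum-cong-≗ λ i → trans
          (cong₂ (λ b c → [ b ] * [ c ]) (Bool.∧-identityʳ (Q i x)) (Bool.∧-identityʳ (Q i y)))
          (sym ([∧] (Q i x) (Q i y)))))
        (≤-trans by-block (≤-reflexive (sym (+-identityʳ _))))
        where
        same-block : ∀ {i} → Q i x ∧ Q i y ≡ true → block y ≡ block x
        same-block {i} both with adj-sound blockGraph {x} {y}
          (Q-clique i x y x≢y (proj₁ (∧-true both)) (proj₂ (∧-true {Q i x} both)))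
        ... | _ , inj₁ differ = ⊥-elim (differ (same-side x y Hx Hy))
        ... | _ , inj₂ same   = sym same
        by-block : ∣ (λ i → Q i x ∧ Q i y) ∣ ≤ [ block y ≡ᵇ block x ]
        by-block with block y ≡ᵇ block x in eq
        ... | false = ≤-reflexive (sum-zero {K} λ i → []-false (≡false λ both → true≢false
          (subst (λ b → (block y ≡ᵇ b) ≡ true) (same-block both) (≡ᵇ-complete (block y))) eq))
        ... | true  = at-most-one (λ i → Q i x ∧ Q i y) λ i j i∋ j∋ →
          let _ , _ , unique = proj₂ partition x y (x≢y , inj₂ (sym (≡ᵇ-sound eq)))
              in-member = λ k k∋ → let x∈ , y∈ = ∧-true {Q k x} {Q k y} k∋ in true⇒∈ x∈ , true⇒∈ y∈
          in trans (sym (unique (in-member i i∋))) (unique (in-member j j∋))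

      -- The diagonal pair counts every member containing `x` once, which is the source of the
      -- linear term in `side-pairs`.
      pair≤ : ∀ x y → (sum λ i → [ QH i x ] * [ QH i y ]) ≤
                      [ δ x y ] * members x + [ H x ] * [ block y ≡ᵇ block x ]
      pair≤ x y = by-cases (x Fin.≟ y)
        where
        []-idem : ∀ b → [ b ] * [ b ] ≡ [ b ]
        []-idem true  = refl
        []-idem false = refl
        by-cases : Dec (x ≡ y) → (sum λ i → [ QH i x ] * [ QH i y ]) ≤
                      [ δ x y ] * members x + [ H x ] * [ block y ≡ᵇ block x ]
        by-cases (yes refl) = ≤-trans (≤-reflexive (sum-cong-≗ λ i → []-idem (QH i x)))
          (≤-trans (≤-reflexive (sym (trans (cong (_* members x) ([]-true (δ-refl x))) (*-identityˡ (members x)))))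
                   (m≤m+n _ _))
        by-cases (no x≢y) = ≤-trans (common≤ x y x≢y) (m≤n+m _ _)

      at-x : ∀ x → (sum λ y → sum λ i → [ QH i x ] * [ QH i y ]) ≤ members x + [ H x ] * S
      at-x x = begin
        (sum λ y → sum λ i → [ QH i x ] * [ QH i y ])
          ≤⟨ sum-mono (pair≤ x) ⟩
        (sum λ y → [ δ x y ] * members x + [ H x ] * [ block y ≡ᵇ block x ])
          ≡⟨ ∑-distrib-+ (λ y → [ δ x y ] * members x) (λ y → [ H x ] * [ block y ≡ᵇ block x ]) ⟩
        (sum λ y → [ δ x y ] * members x) + (sum λ y → [ H x ] * [ block y ≡ᵇ block x ])
          ≡⟨ cong₂ _+_ (*-distribʳ-sum (members x) (λ y → [ δ x y ]))
                       (*-distribˡ-sum [ H x ] (λ y → [ block y ≡ᵇ block x ])) ⟨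
        ∣ δ x ∣ * members x + [ H x ] * ∣ (λ y → block y ≡ᵇ block x) ∣
          ≤⟨ +-mono-≤ (≤-reflexive (trans (cong (_* members x) (∣δ∣ x)) (*-identityˡ (members x))))
                      (*-monoʳ-≤ [ H x ] (block-size {n} S (block x))) ⟩
        members x + [ H x ] * S ∎

    QE QO : Fin K → ℕ
    QE i = ∣ (λ x → Q i x ∧ Even x) ∣
    QO i = ∣ (λ x → Q i x ∧ Odd x) ∣

    cross-edges : ∣ Even ∣ * ∣ Odd ∣ ≤ sum λ i → QE i * QO i
    cross-edges = ≤-trans (≤-reflexive (trans (*-distribʳ-sum ∣ Odd ∣ (λ x → [ Even x ]))
                                              (sum-cong-≗ at-x)))
                          -- With `a` relating even to odd vertices, the left side of
                          -- `covered-edges` counts all cross edges.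
                          (covered-edges {λ x y → Even x ∧ Odd y} cross-adjacent Even Odd)
      where
      at-x : ∀ x → [ Even x ] * ∣ Odd ∣ ≡ [ Even x ] * ∣ (λ y → (Even x ∧ Odd y) ∧ Odd y) ∣
      at-x x with Even x
      ... | true  = cong (_+ 0) (sum-cong-≗ λ y → cong [_] (sym (Bool.∧-idem (Odd y))))
      ... | false = refl
      cross-adjacent : ∀ x y → Even x ∧ Odd y ≡ true → adj blockGraph x y ≡ true
      cross-adjacent x y eq = adj-complete blockGraph {x} {y}
        ((λ x≡y → differ (cong Even x≡y)) , inj₁ differ)
        where
        differ : Even x ≢ Even y
        differ Ex≡Ey = true≢false (proj₁ (∧-true eq))
          (trans Ex≡Ey (odd-not-even (toℕ y) (proj₂ (∧-true {Even x} eq))))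

    -- Sum `e*o-bound` over the members and bound the squares by `side-pairs` on either side; the
    -- linear terms cancel, and `K` remains from the summands 1.
    partition-size : quarter-square n ≤ K + n * S
    partition-size = begin
      quarter-square n    ≡⟨ trans (cong₂ _*_ (sym (∣odd∣ n)) (sym (∣even∣ n))) (*-comm ∣ Odd ∣ ∣ Even ∣) ⟩
      ∣ Even ∣ * ∣ Odd ∣  ≤⟨ cross-edges ⟩
      (sum λ i → QE i * QO i)
        ≤⟨ from-combination (+-mono-≤ per-member
             (+-mono-≤ (side-pairs Even λ x y Ex Ey → trans Ex (sym Ey))
                       (side-pairs Odd λ x y Ox Oy →
                         trans (odd-not-even (toℕ x) Ox) (sym (odd-not-even (toℕ y) Oy)))))
             (e (sum λ i → QE i * QO i) (sum λ i → QE i * QE i) (sum λ i → QO i * QO i)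
                (sum QE) (sum QO) K (∣ Even ∣) (∣ Odd ∣) S) ⟩
      K + (∣ Odd ∣ + ∣ Even ∣) * S
        ≡⟨ cong (λ m → K + m * S) (trans (cong₂ _+_ (∣odd∣ n) (∣even∣ n)) (⌊n/2⌋+⌈n/2⌉≡n n)) ⟩
      K + n * S           ∎
      where
      open ≤-Reasoning
      per-member : (sum λ i → QE i * QO i) + (sum QE + sum QO) ≤
                   K + ((sum λ i → QE i * QE i) + (sum λ i → QO i * QO i))
      per-member = begin
        (sum λ i → QE i * QO i) + (sum QE + sum QO)
          ≡⟨ cong ((sum λ i → QE i * QO i) +_) (∑-distrib-+ QE QO) ⟨
        (sum λ i → QE i * QO i) + (sum λ i → QE i + QO i)
          ≡⟨ ∑-distrib-+ (λ i → QE i * QO i) (λ i → QE i + QO i) ⟨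
        (sum λ i → QE i * QO i + (QE i + QO i))
          ≤⟨ sum-mono (λ i → e*o-bound (QE i) (QO i)) ⟩
        (sum λ i → 1 + (QE i * QE i + QO i * QO i))
          ≡⟨ ∑-distrib-+ {K} (const 1) (λ i → QE i * QE i + QO i * QO i) ⟩
        sum {K} (const 1) + (sum λ i → QE i * QE i + QO i * QO i)
          ≡⟨ cong₂ _+_ (trans (sum-const K 1) (*-identityʳ K))
                       (∑-distrib-+ (λ i → QE i * QE i) (λ i → QO i * QO i)) ⟩
        K + ((sum λ i → QE i * QE i) + (sum λ i → QO i * QO i)) ∎
      e : ∀ c ee oo e o K E O S →
          c + (K + (ee + oo) + (e + E * S + (o + O * S))) ≡
          K + (O + E) * S + (c + (e + o) + (ee + oo))
      e = solve-∀

  cp-blockGraph : quarter-square n ≤ cp blockGraph + n * S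
  cp-blockGraph = let F , partition = proj₁ (proj₂ (cp-exists blockGraph))
                  in partition-size F partition

  module _ (B : ℕ) (n≤B*S : n ≤ B * S) where

    bi-block : ℕ × ℕ → Fin n → Bool
    bi-block (p , q) x = if Even x then block x ≡ᵇ p else block x ≡ᵇ q

    indices : Fin (B * B) → ℕ × ℕ
    indices i = toℕ (proj₁ (remQuot {B} B i)) , toℕ (proj₂ (remQuot {B} B i))

    bi-blocks : Vec (Subset n) (B * B)
    bi-blocks = tabulate λ i → tabulate (bi-block (indices i))

    in-bi-blocks : ∀ i x → lookup (lookup bi-blocks i) x ≡ bi-block (indices i) x
    in-bi-blocks i x = trans (cong (λ S → lookup S x) (lookup∘tabulate (λ i → tabulate (bi-block (indices i))) i))
                             (lookup∘tabulate (bi-block (indices i)) x)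

    bi-block-adjacent : ∀ pq x y → x ≢ y → bi-block pq x ≡ true → bi-block pq y ≡ true →
                        Adj blockGraph x y
    bi-block-adjacent pq x y x≢y x∈ y∈ = x≢y , relation
      where
      relation : Even x ≢ Even y ⊎ block x ≡ block y
      relation with Even x | Even y
      ... | true  | true  = inj₂ (trans (≡ᵇ-sound x∈) (sym (≡ᵇ-sound y∈)))
      ... | false | false = inj₂ (trans (≡ᵇ-sound x∈) (sym (≡ᵇ-sound y∈)))
      ... | true  | false = inj₁ λ ()
      ... | false | true  = inj₁ λ ()

    -- The even and the odd end select the two blocks; for ends of equal parity both are the common
    -- block. The witnesses are vertices, so that their block numbers are below `B`.
    common-indices : ∀ x y → Adj blockGraph x y → ∃₂ λ s t →
      bi-block (block s , block t) x ≡ true × bi-block (block s , block t) y ≡ true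
    common-indices x y (_ , e) with Even x | Even y
    common-indices x y (_ , inj₁ differ) | true  | true  = ⊥-elim (differ refl)
    common-indices x y (_ , inj₁ differ) | false | false = ⊥-elim (differ refl)
    common-indices x y (_ , inj₂ same)   | true  | true  = x , x , ≡ᵇ-complete (block x) ,
      subst (λ b → (block y ≡ᵇ b) ≡ true) (sym same) (≡ᵇ-complete (block y))
    common-indices x y (_ , inj₂ same)   | false | false = x , x , ≡ᵇ-complete (block x) ,
      subst (λ b → (block y ≡ᵇ b) ≡ true) (sym same) (≡ᵇ-complete (block y))
    common-indices x y (_ , _)           | true  | false = x , y , ≡ᵇ-complete (block x) , ≡ᵇ-complete (block y)
    common-indices x y (_ , _)           | false | true  = y , x , ≡ᵇ-complete (block x) , ≡ᵇ-complete (block y)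

    block-index : (x : Fin n) → Fin B
    block-index x = fromℕ< (m<n*o⇒m/o<n (≤-trans (Fin.toℕ<n x) n≤B*S))

    indices-combine : ∀ s t → indices (combine (block-index s) (block-index t)) ≡ (block s , block t)
    indices-combine s t = trans
      (cong (λ (i , j) → toℕ i , toℕ j) (Fin.remQuot-combine (block-index s) (block-index t)))
      (cong₂ _,_ (Fin.toℕ-fromℕ< _) (Fin.toℕ-fromℕ< _))

    cc-blockGraph : cc blockGraph ≤ B * B
    cc-blockGraph = proj₂ (proj₂ (cc-exists blockGraph)) (B * B) (bi-blocks , clique , cover)
      where
      clique : ∀ i → IsClique blockGraph (lookup bi-blocks i)
      clique i x y x∈ y∈ x≢y = bi-block-adjacent (indices i) x y x≢y
        (trans (sym (in-bi-blocks i x)) (∈⇒true x∈)) (trans (sym (in-bi-blocks i y)) (∈⇒true y∈))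
      cover : ∀ x y → Adj blockGraph x y → ∃ λ i → x ∈ lookup bi-blocks i × y ∈ lookup bi-blocks i
      cover x y e =
        let s , t , x∈ , y∈ = common-indices x y e
            i = combine (block-index s) (block-index t)
            member = λ z z∈ → true⇒∈ {S = lookup bi-blocks i} (trans (in-bi-blocks i z)
                       (trans (cong (λ pq → bi-block pq z) (indices-combine s t)) z∈))
        in i , member x x∈ , member y y∈

-- The deficit ⌊n²/4⌋ - σ n as a natural number

-- Passing from n to n + 2 adds 4(n + 1) to the square, so the remainder modulo 4 is kept.
n*n≡ : ∀ n → ∃ λ ε → suc ε ≤ 4 × n * n ≡ ε + quarter-square n * 4
n*n≡ zero          = 0 , s≤s z≤n , refl
n*n≡ (suc zero)    = 1 , s≤s (s≤s z≤n) , refl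
n*n≡ (suc (suc n)) with n*n≡ n
... | ε , ε<4 , eq = ε , ε<4 , (begin
  suc (suc n) * suc (suc n)            ≡⟨ e₁ n ⟩
  n * n + (n * 4 + 4)                  ≡⟨ cong₂ (λ s n → s + (n * 4 + 4)) eq (sym (⌊n/2⌋+⌈n/2⌉≡n n)) ⟩
  ε + ⌊ n /2⌋ * ⌈ n /2⌉ * 4 + ((⌊ n /2⌋ + ⌈ n /2⌉) * 4 + 4) ≡⟨ e₂ ε ⌊ n /2⌋ ⌈ n /2⌉ ⟩
  ε + suc ⌊ n /2⌋ * suc ⌈ n /2⌉ * 4    ∎)
  where
  open ≡-Reasoning
  e₁ : ∀ n → suc (suc n) * suc (suc n) ≡ n * n + (n * 4 + 4)
  e₁ = solve-∀
  e₂ : ∀ ε a b → ε + a * b * 4 + ((a + b) * 4 + 4) ≡ ε + suc a * suc b * 4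
  e₂ = solve-∀

n*n/4≡quarter-square : ∀ n → n * n / 4 ≡ quarter-square n
n*n/4≡quarter-square n with n*n≡ n
... | ε , ε<4 , eq = begin
  n * n / 4                            ≡⟨ cong (_/ 4) eq ⟩
  (ε + quarter-square n * 4) / 4       ≡⟨ +-distrib-/-∣ʳ ε (divides-refl (quarter-square n)) ⟩
  ε / 4 + quarter-square n * 4 / 4     ≡⟨ cong₂ _+_ (m<n⇒m/n≡0 ε<4) (m*n/n≡m (quarter-square n) 4) ⟩
  quarter-square n                     ∎
  where open ≡-Reasoning

ℤ-difference-≤ : ∀ a b c d → ℤ.+ a ℤ.- ℤ.+ b ℤ.≤ ℤ.+ c ℤ.- ℤ.+ d → a + d ≤ c + b
ℤ-difference-≤ a b c d h = ℤ.drop‿+≤+ (subst₂ ℤ._≤_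
  (trans (e (ℤ.+ a) (ℤ.+ b) (ℤ.+ d)) (sym (ℤ.pos-+ a d)))
  (trans (e′ (ℤ.+ c) (ℤ.+ b) (ℤ.+ d)) (sym (ℤ.pos-+ c b)))
  (ℤ.+-monoˡ-≤ (ℤ.+ b ℤ.+ ℤ.+ d) h))
  where
  e : ∀ a b d → a ℤ.- b ℤ.+ (b ℤ.+ d) ≡ a ℤ.+ d
  e = ℤ.solve-∀
  e′ : ∀ c b d → c ℤ.- d ℤ.+ (b ℤ.+ d) ≡ c ℤ.+ b
  e′ = ℤ.solve-∀

ℤ-deficit : ∀ {q p} c → p ≤ q → ℤ.+ q ℤ.- (ℤ.+ p ℤ.- ℤ.+ c) ≡ ℤ.+ ((q ∸ p) + c)
ℤ-deficit {q} {p} c p≤q = begin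
  ℤ.+ q ℤ.- (ℤ.+ p ℤ.- ℤ.+ c)
    ≡⟨ cong (λ q → ℤ.+ q ℤ.- (ℤ.+ p ℤ.- ℤ.+ c)) (m∸n+n≡m p≤q) ⟨
  ℤ.+ (q ∸ p + p) ℤ.- (ℤ.+ p ℤ.- ℤ.+ c)
    ≡⟨ cong (ℤ._- (ℤ.+ p ℤ.- ℤ.+ c)) (ℤ.pos-+ (q ∸ p) p) ⟩
  ℤ.+ (q ∸ p) ℤ.+ ℤ.+ p ℤ.- (ℤ.+ p ℤ.- ℤ.+ c)
    ≡⟨ e (ℤ.+ (q ∸ p)) (ℤ.+ p) (ℤ.+ c) ⟩
  ℤ.+ (q ∸ p) ℤ.+ ℤ.+ c
    ≡⟨ ℤ.pos-+ (q ∸ p) c ⟨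
  ℤ.+ ((q ∸ p) + c) ∎
  where
  open ≡-Reasoning
  e : ∀ m p c → m ℤ.+ p ℤ.- (p ℤ.- c) ≡ m ℤ.+ c
  e = ℤ.solve-∀

record Deficit (n r W B : ℕ) : Set where
  field
    d     : ℕ
    d-eq  : ℤ.+ (n * n / 4) ℤ.- σ n ≡ ℤ.+ d
    upper : d ≤ n * r + B * B
    lower : r * W ≤ d ⊎ (21 * W) * (21 * W) ≤ d * (suc (r * 3) * suc (r * 3))

-- For an extremal graph `G` the deficit is the sum of ⌊n²/4⌋ - cp G and cc G, both nonnegative, so
-- either alternative of `cp-or-cc-bound` bounds it from below. Comparing `G` with the block graph
-- of block size `r` bounds it from above.
deficit : ∀ n r W B .{{_ : NonZero r}} → n ≤ B * r → 252 * W + r ≤ n → Deficit n r W B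
deficit n r W B n≤B*r large = record
  { d     = qs ∸ cp G + cc G
  ; d-eq  = trans (cong₂ (λ q s → ℤ.+ q ℤ.- s) (n*n/4≡quarter-square n) (sym gap-G))
                  (ℤ-deficit (cc G) (cp≤quarter-square G))
  ; upper = +-cancelʳ-≤ (cp G) _ _ (begin
      qs ∸ cp G + cc G + cp G                 ≡⟨ e₁ (qs ∸ cp G) (cc G) (cp G) ⟩
      qs ∸ cp G + cp G + cc G                 ≡⟨ cong (_+ cc G) (m∸n+n≡m (cp≤quarter-square G)) ⟩
      qs + cc G                               ≤⟨ +-monoˡ-≤ (cc G) cp-blockGraph ⟩
      cp blockGraph + n * r + cc G           ≡⟨ e₂ (cp blockGraph) (n * r) (cc G) ⟩
      n * r + (cp blockGraph + cc G)         ≤⟨ +-monoʳ-≤ (n * r) (ℤ-difference-≤ (cp blockGraph) (cc blockGraph) (cp G) (cc G)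
                                                  (ℤ.≤-trans (maximal blockGraph) (ℤ.≤-reflexive (sym gap-G)))) ⟩
      n * r + (cp G + cc blockGraph)         ≤⟨ +-monoʳ-≤ (n * r) (+-monoʳ-≤ (cp G) (cc-blockGraph B n≤B*r)) ⟩
      n * r + (cp G + B * B)                 ≡⟨ e₃ (n * r) (cp G) (B * B) ⟩
      n * r + B * B + cp G                   ∎)
  ; lower = Data.Sum.map
      (λ cheap → ≤-trans (m+n≤o⇒n≤o∸m (cp G) cheap) (m≤m+n _ (cc G)))
      (λ many → ≤-trans many (*-monoˡ-≤ (suc (r * 3) * suc (r * 3)) (m≤n+m (cc G) (qs ∸ cp G))))
      (cp-or-cc-bound G W r large)
  }
  where
  open ≤-Reasoning
  open BlockGraph n r
  qs = quarter-square n
  G = proj₁ (proj₁ (proj₂ (σ-exists n)))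
  gap-G : gap G ≡ σ n
  gap-G = proj₂ (proj₁ (proj₂ (σ-exists n)))
  maximal = proj₂ (proj₂ (σ-exists n))
  m+n≤o⇒n≤o∸m : ∀ m {n o} → m + n ≤ o → n ≤ o ∸ m
  m+n≤o⇒n≤o∸m m {n} {o} h = ≤-trans (≤-reflexive (sym (m+n∸m≡n m n))) (∸-monoˡ-≤ m h)
  e₁ : ∀ m c p → m + c + p ≡ m + p + c
  e₁ = solve-∀
  e₂ : ∀ b s c → b + s + c ≡ s + (b + c)
  e₂ = solve-∀
  e₃ : ∀ s p b → s + (p + b) ≡ s + b + p
  e₃ = solve-∀

-- Asymptotics and rational constants

cubeℕ : ℕ → ℕ
cubeℕ x = x * x * x

cubeℕ-mono : ∀ {x y} → x ≤ y → cubeℕ x ≤ cubeℕ y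
cubeℕ-mono x≤y = *-mono-≤ (*-mono-≤ x≤y x≤y) x≤y

cube-root : ∀ n → ∃ λ r → cubeℕ r ≤ n × suc n ≤ cubeℕ (suc r)
cube-root zero = 0 , z≤n , s≤s z≤n
cube-root (suc n) with cube-root n
... | r , r³≤n , n<1+r³ with suc (suc n) ≤? cubeℕ (suc r)
...   | yes below = r , m≤n⇒m≤1+n r³≤n , below
...   | no ¬below = suc r , ≤-pred (≰⇒> ¬below) ,
  ≤-trans (s≤s n<1+r³) (*-mono-< (*-mono-< (n<1+n (suc r)) (n<1+n (suc r))) (n<1+n (suc r)))

fromℤ≃ : ∀ z → ℚ.toℚᵘ (fromℤ z) ℚᵘ.≃ ℚᵘ.mkℚᵘ z 0
fromℤ≃ z = ℚ.toℚᵘ-fromℚᵘ (ℚᵘ.mkℚᵘ z 0)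

fromℕ : ℕ → ℚ.ℚ
fromℕ m = fromℤ (ℤ.+ m)

fromℕ-* : ∀ m n → fromℕ (m * n) ≡ fromℕ m ℚ.* fromℕ n
fromℕ-* m n = ℚ.toℚᵘ-injective (begin
  ℚ.toℚᵘ (fromℕ (m * n))                      ≈⟨ fromℤ≃ (ℤ.+ (m * n)) ⟩
  ℚᵘ.mkℚᵘ (ℤ.+ (m * n)) 0                     ≡⟨ cong (λ z → ℚᵘ.mkℚᵘ z 0) (ℤ.pos-* m n) ⟩
  ℚᵘ.mkℚᵘ (ℤ.+ m) 0 ℚᵘ.* ℚᵘ.mkℚᵘ (ℤ.+ n) 0    ≈⟨ ℚᵘ.*-cong (fromℤ≃ (ℤ.+ m)) (fromℤ≃ (ℤ.+ n)) ⟨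
  ℚ.toℚᵘ (fromℕ m) ℚᵘ.* ℚ.toℚᵘ (fromℕ n)      ≈⟨ ℚ.toℚᵘ-homo-* (fromℕ m) (fromℕ n) ⟨
  ℚ.toℚᵘ (fromℕ m ℚ.* fromℕ n)                ∎)
  where open import Relation.Binary.Reasoning.Setoid ℚᵘ.≃-setoid

fromℕ-mono : ∀ {m n} → m ≤ n → fromℕ m ℚ.≤ fromℕ n
fromℕ-mono {m} {n} m≤n = ℚ.toℚᵘ-cancel-≤ (begin
  ℚ.toℚᵘ (fromℕ m)    ≃⟨ fromℤ≃ (ℤ.+ m) ⟩
  ℚᵘ.mkℚᵘ (ℤ.+ m) 0   ≤⟨ ℚᵘ.*≤* (ℤ.*-monoʳ-≤-nonNeg (ℤ.+ 1) (ℤ.+≤+ m≤n)) ⟩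
  ℚᵘ.mkℚᵘ (ℤ.+ n) 0   ≃⟨ fromℤ≃ (ℤ.+ n) ⟨
  ℚ.toℚᵘ (fromℕ n)    ∎)
  where open ℚᵘ.≤-Reasoning

fromℕ-cube : ∀ m → fromℕ (cubeℕ m) ≡ cube (fromℕ m)
fromℕ-cube m = trans (fromℕ-* (m * m) m) (cong (ℚ._* fromℕ m) (fromℕ-* m m))

upper-4/3 : ∀ K d n → cubeℕ d ≤ cubeℕ K * n ^ 4 → fromℕ d ≤ fromℕ K · n ^4/3
upper-4/3 K d n h = subst₂ ℚ._≤_ (fromℕ-cube d)
  (trans (fromℕ-* (cubeℕ K) (n ^ 4)) (cong (ℚ._* fromℕ (n ^ 4)) (fromℕ-cube K)))
  (fromℕ-mono h)

-- Here `C` is 1/K, and the claim is the inequality of natural numbers multiplied by C³.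
lower-4/3 : ∀ C K d n → C ℚ.* fromℕ K ≡ ℚ.1ℚ → ℚ.0ℚ ℚ.≤ cube C →
            n ^ 4 ≤ cubeℕ K * cubeℕ d → C · n ^4/3≤ fromℕ d
lower-4/3 C K d n C*K≡1 0≤C³ h = begin
  cube C ℚ.* fromℕ (n ^ 4)                     ≤⟨ ℚ.*-monoˡ-≤-nonNeg (cube C) {{ℚ.nonNegative 0≤C³}} (fromℕ-mono h) ⟩
  cube C ℚ.* fromℕ (cubeℕ K * cubeℕ d)         ≡⟨ cong (cube C ℚ.*_) (trans (fromℕ-* (cubeℕ K) (cubeℕ d))
                                                    (cong₂ ℚ._*_ (fromℕ-cube K) (fromℕ-cube d))) ⟩
  cube C ℚ.* (cube (fromℕ K) ℚ.* cube (fromℕ d)) ≡⟨ ℚ.*-assoc (cube C) _ _ ⟨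
  cube C ℚ.* cube (fromℕ K) ℚ.* cube (fromℕ d) ≡⟨ cong (ℚ._* cube (fromℕ d)) (cube-* C (fromℕ K)) ⟩
  cube (C ℚ.* fromℕ K) ℚ.* cube (fromℕ d)      ≡⟨ cong (λ x → cube x ℚ.* cube (fromℕ d)) C*K≡1 ⟩
  cube ℚ.1ℚ ℚ.* cube (fromℕ d)                 ≡⟨ ℚ.*-identityˡ (cube (fromℕ d)) ⟩
  cube (fromℕ d)                               ∎
  where
  open ℚ.≤-Reasoning
  cube-* : ∀ x y → cube x ℚ.* cube y ≡ cube (x ℚ.* y)
  cube-* x y = trans (interchange (x ℚ.* x) x (y ℚ.* y) y) (cong (ℚ._* (x ℚ.* y)) (interchange x x y y))
    where open import Algebra.Properties.CommutativeSemigroup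
                 (CommutativeMonoid.commutativeSemigroup ℚ.*-1-commutativeMonoid) using (interchange)

fourth : ℕ → ℕ
fourth r = r * r * r * r

cubeℕ-* : ∀ x y → cubeℕ (x * y) ≡ cubeℕ x * cubeℕ y
cubeℕ-* = e
  where
  e : ∀ x y → x * y * (x * y) * (x * y) ≡ x * x * x * (y * y * y)
  e = solve-∀

cubeℕ-fourth : ∀ r → cubeℕ (fourth r) ≡ cubeℕ r ^ 4
cubeℕ-fourth = e
  where
  e : ∀ r → r * r * r * r * (r * r * r * r) * (r * r * r * r) ≡
            r * r * r * (r * r * r * (r * r * r * (r * r * r * 1)))
  e = solve-∀

-- Under these bounds n^{4/3} lies between r⁴ and 16r⁴, so it suffices to compare `d` with r⁴.
module Asymptotics (n r W d : ℕ) .{{_ : NonZero r}}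
                   (r³≤n : cubeℕ r ≤ n) (n≤8r³ : n ≤ 8 * (r * r) * r) where

  -- 72 = 8 + 64: the first term is at most 8r⁴, and 8r² blocks contribute 64r⁴.
  d-upper : d ≤ n * r + (8 * (r * r)) * (8 * (r * r)) → cubeℕ d ≤ cubeℕ 72 * n ^ 4
  d-upper d≤ = begin
    cubeℕ d                         ≤⟨ cubeℕ-mono (≤-trans d≤ (+-monoˡ-≤ _ (*-monoˡ-≤ r n≤8r³))) ⟩
    cubeℕ (8 * (r * r) * r * r + (8 * (r * r)) * (8 * (r * r))) ≡⟨ cong cubeℕ (e r) ⟩
    cubeℕ (72 * fourth r)           ≡⟨ cubeℕ-* 72 (fourth r) ⟩
    cubeℕ 72 * cubeℕ (fourth r)     ≡⟨ cong (cubeℕ 72 *_) (cubeℕ-fourth r) ⟩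
    cubeℕ 72 * cubeℕ r ^ 4          ≤⟨ *-monoʳ-≤ (cubeℕ 72) (^-monoˡ-≤ 4 r³≤n) ⟩
    cubeℕ 72 * n ^ 4                ∎
    where
    open ≤-Reasoning
    e : ∀ r → 8 * (r * r) * r * r + (8 * (r * r)) * (8 * (r * r)) ≡ 72 * (r * r * r * r)
    e = solve-∀

  d-lower : ∀ M → fourth r ≤ M * d → n ^ 4 ≤ cubeℕ (16 * M) * cubeℕ d
  d-lower M r⁴≤ = begin
    n ^ 4                           ≤⟨ ^-monoˡ-≤ 4 (≤-trans n≤8r³ (≤-reflexive (e₁ r))) ⟩
    cubeℕ (2 * r) ^ 4               ≡⟨ cubeℕ-fourth (2 * r) ⟨
    cubeℕ (fourth (2 * r))          ≡⟨ cong cubeℕ (e₂ r) ⟩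
    cubeℕ (16 * fourth r)           ≤⟨ cubeℕ-mono (*-monoʳ-≤ 16 r⁴≤) ⟩
    cubeℕ (16 * (M * d))            ≡⟨ cong cubeℕ (*-assoc 16 M d) ⟨
    cubeℕ (16 * M * d)              ≡⟨ cubeℕ-* (16 * M) d ⟩
    cubeℕ (16 * M) * cubeℕ d        ∎
    where
    open ≤-Reasoning
    e₁ : ∀ r → 8 * (r * r) * r ≡ 2 * r * (2 * r) * (2 * r)
    e₁ = solve-∀
    e₂ : ∀ r → 2 * r * (2 * r) * (2 * r) * (2 * r) ≡ 16 * (r * r * r * r)
    e₂ = solve-∀

  -- In the second case 1008 = 48 · 21 gives the factor 48² = 2304, and 3r + 1 ≤ 4r a further 16;
  -- the product 36864 also exceeds the 1008 of the first case.
  fourth-bound : cubeℕ r ≤ 1008 * W →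
    r * W ≤ d ⊎ (21 * W) * (21 * W) ≤ d * (suc (r * 3) * suc (r * 3)) → fourth r ≤ 36864 * d
  fourth-bound r³≤ (inj₁ rW≤d) = begin
    fourth r             ≤⟨ *-monoˡ-≤ r r³≤ ⟩
    1008 * W * r         ≡⟨ trans (*-assoc 1008 W r) (cong (1008 *_) (*-comm W r)) ⟩
    1008 * (r * W)       ≤⟨ *-mono-≤ (m≤m+n 1008 35856) rW≤d ⟩
    36864 * d            ∎
    where open ≤-Reasoning
  fourth-bound r³≤ (inj₂ many) = *-cancelʳ-≤ (fourth r) (36864 * d) (r * r) {{m*n≢0 r r}} (begin
    fourth r * (r * r)                           ≡⟨ e₁ r ⟩
    cubeℕ r * cubeℕ r                            ≤⟨ *-mono-≤ r³≤ r³≤ ⟩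
    1008 * W * (1008 * W)                        ≡⟨ e₂ W ⟩
    2304 * (21 * W * (21 * W))                   ≤⟨ *-monoʳ-≤ 2304 many ⟩
    2304 * (d * (suc (r * 3) * suc (r * 3)))     ≤⟨ *-monoʳ-≤ 2304 (*-monoʳ-≤ d (*-mono-≤ 3r+1≤4r 3r+1≤4r)) ⟩
    2304 * (d * (r * 4 * (r * 4)))               ≡⟨ e₃ d r ⟩
    36864 * d * (r * r)                          ∎)
    where
    open ≤-Reasoning
    3r+1≤4r : suc (r * 3) ≤ r * 4
    3r+1≤4r = ≤-trans (+-monoˡ-≤ (r * 3) (>-nonZero⁻¹ r)) (≤-reflexive (sym (*-suc r 3)))
    e₁ : ∀ r → r * r * r * r * (r * r) ≡ r * r * r * (r * r * r)
    e₁ = solve-∀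
    e₂ : ∀ W → 1008 * W * (1008 * W) ≡ 2304 * (21 * W * (21 * W))
    e₂ = solve-∀
    e₃ : ∀ d r → 2304 * (d * (r * 4 * (r * 4))) ≡ 36864 * d * (r * r)
    e₃ = solve-∀

-- Choice of the parameters and constants

record Scale (n : ℕ) : Set where
  field
    r W       : ℕ
    r≢0       : NonZero r
    r³≤n      : cubeℕ r ≤ n
    n≤8r³     : n ≤ 8 * (r * r) * r
    r³≤1008W  : cubeℕ r ≤ 1008 * W
    252W+r≤n  : 252 * W + r ≤ n

-- `r` is the integer cube root and W = ⌊r³/504⌋, so 252W takes at most half of r³ and leaves room
-- for `r`. As 512 = 8³, r ≥ 8 and W is positive; rounding then costs at most a factor 2, whence
-- 1008.
scale : ∀ n → 512 ≤ n → Scale n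
scale n 512≤n = record
  { r = r ; W = W ; r≢0 = >-nonZero (≤-trans (s≤s z≤n) 8≤r) ; r³≤n = r³≤n
  ; n≤8r³ = ≤-trans (<⇒≤ n<) (≤-trans (cubeℕ-mono 1+r≤2r) (≤-reflexive (e₁ r)))
  ; r³≤1008W = begin
      cubeℕ r                    ≡⟨ m≡m%n+[m/n]*n (cubeℕ r) 504 ⟩
      cubeℕ r % 504 + W * 504    ≤⟨ +-monoˡ-≤ (W * 504) (≤-trans (m%n≤n (cubeℕ r) 504)
                                      (≤-trans (m≤m*n 504 W {{>-nonZero W>0}}) (≤-reflexive (*-comm 504 W)))) ⟩
      W * 504 + W * 504          ≡⟨ e₂ W ⟩
      1008 * W                   ∎
  ; 252W+r≤n = ≤-trans (*-cancelˡ-≤ 2 (begin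
      2 * (252 * W + r)          ≡⟨ e₃ W r ⟩
      W * 504 + 2 * r            ≤⟨ +-mono-≤ (m/n*n≤m (cubeℕ r) 504) 2r≤r³ ⟩
      cubeℕ r + cubeℕ r          ≡⟨ cong (cubeℕ r +_) (+-identityʳ (cubeℕ r)) ⟨
      2 * cubeℕ r                ∎)) r³≤n
  }
  where
  open ≤-Reasoning
  r = proj₁ (cube-root n)
  r³≤n = proj₁ (proj₂ (cube-root n))
  n< = proj₂ (proj₂ (cube-root n))
  W = cubeℕ r / 504
  8≤r : 8 ≤ r
  8≤r = ≮⇒≥ λ r<8 → <⇒≱ (≤-trans n< (cubeℕ-mono r<8)) 512≤n
  W>0 : 1 ≤ W
  W>0 = m≥n⇒m/n>0 (≤-trans (m≤m+n 504 8) (cubeℕ-mono 8≤r))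
  1+r≤2r : suc r ≤ 2 * r
  1+r≤2r = ≤-trans (+-monoˡ-≤ r (≤-trans (s≤s z≤n) 8≤r)) (≤-reflexive (cong (r +_) (sym (+-identityʳ r))))
  2r≤r³ : 2 * r ≤ cubeℕ r
  2r≤r³ = *-monoˡ-≤ r (≤-trans (s≤s (s≤s z≤n)) (*-mono-≤ 8≤r 8≤r))
  e₁ : ∀ r → 2 * r * (2 * r) * (2 * r) ≡ 8 * (r * r) * r
  e₁ = solve-∀
  e₂ : ∀ W → W * 504 + W * 504 ≡ 1008 * W
  e₂ = solve-∀
  e₃ : ∀ W r → 2 * (252 * W + r) ≡ W * 504 + 2 * r
  e₃ = solve-∀

open import Data.Integer using (+_; _-_)
open import Data.Rational using (ℚ; 0ℚ; _<_)

theorem1p2 : ∃ λ (C₁ : ℚ) → ∃ λ (C₂ : ℚ) → 0ℚ < C₁ × 0ℚ < C₂ ×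
    (∃ λ (N : ℕ) → ∀ (n : ℕ) → N ≤ n →
    (fromℤ (+ (n * n / 4) - σ n) ≤ C₁ · n ^4/3) ×
    (C₂ · n ^4/3≤ fromℤ (+ (n * n / 4) - σ n)))
theorem1p2 = fromℕ 72 , C₂ , from-yes (0ℚ ℚ.<? fromℕ 72) , from-yes (0ℚ ℚ.<? C₂) , 512 , bounds
  where
  C₂ : ℚ
  -- 589824 = 16 · 36864, with 16 from n^{4/3} ≤ 16r⁴ and 36864 from `fourth-bound`.
  C₂ = + 1 ℚ./ 589824
  bounds : ∀ n → 512 ≤ n → (fromℤ (+ (n * n / 4) - σ n) ≤ fromℕ 72 · n ^4/3) ×
                           (C₂ · n ^4/3≤ fromℤ (+ (n * n / 4) - σ n))
  bounds n 512≤n = subst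
    (λ z → (fromℤ z ≤ fromℕ 72 · n ^4/3) × (C₂ · n ^4/3≤ fromℤ z)) (sym d-eq)
    ( upper-4/3 72 d n (d-upper upper)
    , lower-4/3 C₂ 589824 d n refl (from-yes (0ℚ ℚ.≤? cube C₂))
        (d-lower 36864 (fourth-bound r³≤1008W lower)) )
    where
    open Scale (scale n 512≤n)
    -- As n ≤ 8r³, 8r² blocks of size `r` suffice.
    open Deficit (deficit n r W (8 * (r * r)) {{r≢0}} n≤8r³ 252W+r≤n)
    open Asymptotics n r W d {{r≢0}} r³≤n n≤8r³
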